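{- Let $G$ be a finite connected graph with subdivision number $\eta$, let $capt$ be the number of rounds needed for the single cop to win the Robber Locating Game on $G^{1/\eta}$, and let $\delta$ be the diameter of $G$. Then the localization number of $G$ satisfies $\zeta(G)=O\big(2^{capt/\eta}\,16^{\eta}\,\delta^{2\eta}\big)$.
   Context: Robber Locating Game on a graph: an invisible robber first chooses a vertex. In each round, the cops first simultaneously probe vertices anywhere in the graph, each probe returning the graph distance from the probed vertex to the robber's current position; then the robber moves to an adjacent vertex or stays put. The cops win when the set of robber positions consistent with all information has size $1$. A graph is localizable with $k$ cops if the cops have a strategy guaranteeing a win in finite time. The localization number $\zeta(G)$ is the minimum number of cops for which $G$ is localizable. For an integer $m\ge 1$, $G^{1/m}$ is the graph obtained from $G$ by replacing each edge with a path of length $m$. The subdivision number $\eta$ of $G$ is the minimum $m$ such that $G^{1/m}$ is localizable with one cop. The capture time $capt$ is the minimum number of rounds within which a single cop can guarantee to locate the robber on $G^{1/\eta}$. -}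

module Defs where

open import Data.Nat using (ℕ; zero; suc; _≤_; _<_; _∸_)
open import Data.Fin using (Fin; toℕ)
import Data.Fin as F
open import Data.Bool using (Bool; true; false)
open import Data.Product using (Σ; ∃; _×_; _,_; proj₁)
open import Data.Sum using (_⊎_)
open import Data.Unit using (⊤)
open import Relation.Nullary using (¬_)
open import Relation.Binary.PropositionalEquality using (_≡_)

record Graph : Set₁ where
  field
    V   : Set
    _~_ : V → V → Set

open Graph public

record SimpleGraph (n : ℕ) : Set where
  field
    adj    : Fin n → Fin n → Bool
    sym    : ∀ u v → adj u v ≡ adj v u
    irrefl : ∀ v → adj v v ≡ false

open SimpleGraph public

toGraph : ∀ {n} → SimpleGraph n → Graph
toGraph {n} G = record { V = Fin n ; _~_ = λ u v → adj G u v ≡ true }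

data Walk (H : Graph) : V H → V H → ℕ → Set where
  here : ∀ x → Walk H x x zero
  step : ∀ {x y z k} → _~_ H x y → Walk H y z k → Walk H x z (suc k)

Dist : (H : Graph) → V H → V H → ℕ → Set
Dist H x y d = Walk H x y d × (∀ k → Walk H x y k → d ≤ k)

Connected : Graph → Set
Connected H = ∀ x y → ∃ λ k → Walk H x y k

IsDiameter : Graph → ℕ → Set
IsDiameter H δ =
  (∀ x y → ∃ λ d → Dist H x y d × d ≤ δ) × (∃ λ x → ∃ λ y → Dist H x y δ)

-- The subdivision G^{1/m}: every edge {u,v} (u < v) is replaced by a path
-- u — (e,0) — (e,1) — … — (e,m-2) — v of length m.

Edge : ∀ {n} → SimpleGraph n → Set
Edge {n} G = Σ (Fin n × Fin n) λ { (u , v) → (u F.< v) × (adj G u v ≡ true) }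

src tgt : ∀ {n} {G : SimpleGraph n} → Edge G → Fin n
src ((u , v) , _) = u
tgt ((u , v) , _) = v

SubV : ∀ {n} → SimpleGraph n → ℕ → Set
SubV {n} G m = Fin n ⊎ (Edge G × Fin (m ∸ 1))

data Step {n} (G : SimpleGraph n) (m : ℕ) : SubV G m → SubV G m → Set where
  orig  : ∀ {u v} → m ≡ 1 → adj G u v ≡ true →
          Step G m (Data.Sum.inj₁ u) (Data.Sum.inj₁ v)
  start : ∀ {e i} → toℕ i ≡ 0 →
          Step G m (Data.Sum.inj₁ (src {G = G} e)) (Data.Sum.inj₂ (e , i))
  mid   : ∀ {e e' i j} → src {G = G} e ≡ src {G = G} e' → tgt {G = G} e ≡ tgt {G = G} e' →
          toℕ j ≡ suc (toℕ i) →
          Step G m (Data.Sum.inj₂ (e , i)) (Data.Sum.inj₂ (e' , j))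
  end   : ∀ {e i} → suc (toℕ i) ≡ m ∸ 1 →
          Step G m (Data.Sum.inj₂ (e , i)) (Data.Sum.inj₁ (tgt {G = G} e))

subdivide : ∀ {n} → SimpleGraph n → ℕ → Graph
subdivide G m = record
  { V = SubV G m
  ; _~_ = λ x y → Step G m x y ⊎ Step G m y x }

-- The Robber Locating Game with k cops on a graph H.
-- Sets of possible robber positions are predicates on vertices.

AtMostOne : {A : Set} → (A → Set) → Set
AtMostOne S = ∀ x y → S x → S y → x ≡ y

-- closed neighbourhood of a set: positions after the robber moves or stays
ClosedNbhd : (H : Graph) → (V H → Set) → V H → Set
ClosedNbhd H S y = ∃ λ z → S z × (z ≡ y ⊎ _~_ H z y)

SameAnswer : (H : Graph) → V H → V H → V H → Set
SameAnswer H p x y = ∀ d → (Dist H p x d → Dist H p y d) × (Dist H p y d → Dist H p x d)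

-- WinIn H k t S : starting from the set S of possible robber positions
-- (before the probes of the next round), k cops can guarantee that the
-- set of consistent positions has size ≤ 1 within t rounds.
WinIn : (H : Graph) → ℕ → ℕ → (V H → Set) → Set
WinIn H k zero    S = AtMostOne S
WinIn H k (suc t) S =
  AtMostOne S ⊎
  Σ (Fin k → V H) λ p →
    ∀ x → S x →
      let Sx : V H → Set
          Sx = λ y → S y × (∀ j → SameAnswer H (p j) x y)
      in AtMostOne Sx ⊎ WinIn H k t (ClosedNbhd H Sx)

Localizable : Graph → ℕ → Set
Localizable H k = ∃ λ t → WinIn H k t (λ _ → ⊤)

IsLocalizationNumber : Graph → ℕ → Set
IsLocalizationNumber H ζ = Localizable H ζ × (∀ j → j < ζ → ¬ Localizable H j)

IsSubdivisionNumber : ∀ {n} → SimpleGraph n → ℕ → Set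
IsSubdivisionNumber G η =
  1 ≤ η × Localizable (subdivide G η) 1 ×
  (∀ m → 1 ≤ m → m < η → ¬ Localizable (subdivide G m) 1)

IsCaptureTime : ∀ {n} → SimpleGraph n → ℕ → ℕ → Set
IsCaptureTime G η c =
  WinIn (subdivide G η) 1 c (λ _ → ⊤) ×
  (∀ t → t < c → ¬ WinIn (subdivide G η) 1 t (λ _ → ⊤))

{-# OPTIONS --safe #-}
module Submission where

-- Let η be the subdivision number.  A robber walking on G, one edge per round, is also a robber walking
-- on G^{1/η}, one subdivided edge per η rounds, so cops on G can simulate the winning cop of G^{1/η}:
-- the distance from a probe p to a point of the edge uv depends only on the distances in G from the ends
-- of p to u and to v.  The cops on G must therefore probe the ends of p both when the robber is at u and
-- when he is at v, i.e. before they know which p the strategy calls for; they probe all candidates.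
-- While v is probed, the η - 1 probes along uv have at most 5 possible answers each (the distances
-- to u are known), and the probe at v and the next η - 1 ones at most 4δ + 3; for δ ≥ 2 this gives
-- at most O((5 (4δ + 3))^η) ≤ O(16^η δ^{2η}) candidates.  Whether the robber moved or stayed
-- put cannot be observed, so one simulation is run for each of the 2^{capt/η + 1} possible patterns.
-- The cops also probe the ends of every location the strategy may announce, hence a simulation that
-- announces one either catches the robber or is refuted.
-- For δ = 1 the graph is complete; there a probe cannot distinguish targets other than its own two ends,
-- so the robber escapes on G^{1/η} unless n ≤ 2η + 3, while n cops always suffice on G.

open import Defs renaming (sym to adj-sym)
open import Axiom.UniquenessOfIdentityProofs using (module Decidable⇒UIP)
open import Data.Bool using (true)
import Data.Bool.Properties as B
open import Data.Empty using (⊥; ⊥-elim)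
open import Data.Fin using (Fin; toℕ; fromℕ<)
import Data.Fin.Properties as F
open import Data.List using (List; []; _∷_; _++_; map; upTo; concatMap; length; lookup)
open import Data.List.Membership.DecPropositional using (_∈?_)
open import Data.List.Membership.Propositional using (_∈_; _∉_; lose)
open import Data.List.Membership.Propositional.Properties using (∈-++⁺ˡ; ∈-++⁺ʳ; ∈-map⁺; ∈-upTo⁺; ∈-concatMap⁺)
open import Data.List.Properties using (length-map; length-++; length-upTo)
open import Data.List.Relation.Binary.Subset.Propositional using (_⊆_)
open import Data.List.Relation.Unary.Any using (here; there; index)
open import Data.List.Relation.Unary.Any.Properties using (lookup-index)
open import Data.Nat
open import Data.Nat.DivMod using (m/n*n≤m; m≡m%n+[m/n]*n; m%n<n)
open import Data.Nat.Properties
open import Data.Nat.Tactic.RingSolver using (solve-∀)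
open import Data.Product using (Σ; ∃; _×_; _,_; proj₁; proj₂)
open import Data.Sum using (_⊎_; inj₁; inj₂; swap; map₂)
open import Data.Unit using (⊤; tt)
open import Function using (const; _∘_; id)
open import Relation.Binary.Definitions using (tri<; tri≈; tri>)
open import Relation.Binary.PropositionalEquality
open import Relation.Nullary using (¬_; Dec; yes; no)
open import Relation.Nullary.Decidable using (_×-dec_; _⊎-dec_)

-- Walks and distances

private variable
  H : Graph

infixr 5 _++ʷ_

_++ʷ_ : ∀ {x y z k l} → Walk H x y k → Walk H y z l → Walk H x z (k + l)
here _   ++ʷ w′ = w′
step s w ++ʷ w′ = step s (w ++ʷ w′)

snoc : ∀ {x y z k} → Walk H x y k → _~_ H y z → Walk H x z (suc k)
snoc (here _)   s = step s (here _)
snoc (step r w) s = step r (snoc w s)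

reverse : (∀ {x y} → _~_ H x y → _~_ H y x) → ∀ {x y k} → Walk H x y k → Walk H y x k
reverse ~-sym (here x)   = here x
reverse ~-sym (step s w) = snoc (reverse ~-sym w) (~-sym s)

⊓-walk : ∀ {x y k l} → Walk H x y k → Walk H x y l → Walk H x y (k ⊓ l)
⊓-walk {H} {x} {y} {k} {l} v w with ⊓-sel k l
... | inj₁ eq = subst (Walk H x y) (sym eq) v
... | inj₂ eq = subst (Walk H x y) (sym eq) w

-- Source of all lower bounds on distances: a function that vanishes at the start and grows by at
-- most one per edge cannot exceed the length of a walk.
lipschitz-walk : (f : V H → ℕ) → (∀ {x y} → _~_ H x y → f y ≤ suc (f x)) →
                 ∀ {x y k} → Walk H x y k → f y ≤ f x + k
lipschitz-walk f lip (here x) = m≤m+n (f x) 0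
lipschitz-walk f lip {x} (step {y = z} {k = k} s w) =
  ≤-trans (lipschitz-walk f lip w)
          (≤-trans (+-monoˡ-≤ k (lip s)) (≤-reflexive (sym (+-suc (f x) k))))

Dist-unique : ∀ {x y a b} → Dist H x y a → Dist H x y b → a ≡ b
Dist-unique (v , v-min) (w , w-min) = ≤-antisym (v-min _ w) (w-min _ v)

Dist-refl : ∀ x → Dist H x x 0
Dist-refl x = here x , λ _ _ → z≤n

module _ {f : V H → V H → ℕ} (dist : ∀ x y → Dist H x y (f x y)) where

  sameAnswer⇒≡ : ∀ {p x y} → SameAnswer H p x y → f p x ≡ f p y
  sameAnswer⇒≡ {p} {x} {y} same = Dist-unique (proj₁ (same _) (dist p x)) (dist p y)

  ≡⇒sameAnswer : ∀ {p x y} → f p x ≡ f p y → SameAnswer H p x y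
  ≡⇒sameAnswer {p} {x} {y} eq r = to eq , to (sym eq)
    where
    to : ∀ {x y} → f p x ≡ f p y → Dist H p x r → Dist H p y r
    to {x} {y} eq D = subst (Dist H p y) (trans (sym eq) (Dist-unique (dist p x) D)) (dist p y)

-- Distance formulas for points of a subdivision

sel : ℕ → ℕ → ℕ → ℕ → ℕ
sel zero    zero    s g = s
sel zero    (suc _) s g = g
sel (suc _) _       s g = g

sel-elim : (P : ℕ → Set) → ∀ A B {s g} → (A ≡ 0 → B ≡ 0 → P s) → P g → P (sel A B s g)
sel-elim P zero    zero    f g = f refl refl
sel-elim P zero    (suc _) f g = g
sel-elim P (suc _) _       f g = g

sel-comm : ∀ A B s g → sel A B s g ≡ sel B A s g
sel-comm zero    zero    s g = refl
sel-comm zero    (suc _) s g = refl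
sel-comm (suc _) zero    s g = refl
sel-comm (suc _) (suc _) s g = refl

sel-mono : ∀ A B {s g s′ g′} → s ≤ suc s′ → g ≤ suc g′ → sel A B s g ≤ suc (sel A B s′ g′)
sel-mono zero    zero    s≤ g≤ = s≤
sel-mono zero    (suc _) s≤ g≤ = g≤
sel-mono (suc _) _       s≤ g≤ = g≤

∣-∣-lipschitz : ∀ j {a b} → a ≤ suc b → b ≤ suc a → ∣ j - a ∣ ≤ suc ∣ j - b ∣
∣-∣-lipschitz j {a} {b} a≤ b≤ = begin
  ∣ j - a ∣             ≤⟨ ∣-∣-triangle j b a ⟩
  ∣ j - b ∣ + ∣ b - a ∣ ≤⟨ +-monoʳ-≤ ∣ j - b ∣ (gap b a b≤ a≤) ⟩
  ∣ j - b ∣ + 1         ≡⟨ +-comm ∣ j - b ∣ 1 ⟩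
  suc ∣ j - b ∣         ∎
  where
  open ≤-Reasoning
  gap : ∀ b a → b ≤ suc a → a ≤ suc b → ∣ b - a ∣ ≤ 1
  gap zero    a       _         a≤       = a≤
  gap (suc b) zero    b≤        _        = b≤
  gap (suc b) (suc a) (s≤s b≤) (s≤s a≤) = gap b a b≤ a≤

module Formula (η : ℕ) where

  -- The distance from a point p lying j steps from its end a and η - j steps from its end b to a vertex
  -- at distances A and B from a and b.
  toVertex : (j A B : ℕ) → ℕ
  toVertex j A B = (j + A * η) ⊓ ((η ∸ j) + B * η)

  -- Likewise to the point k steps before v on the edge uv, where u is at distances A, B and v at A′, B′.
  -- Only if p lies on uv itself can a shortest path avoid u and v; this is what sel detects.
  throughEnds : (j k A B A′ B′ : ℕ) → ℕ
  throughEnds j k A B A′ B′ = (toVertex j A B + (η ∸ k)) ⊓ (toVertex j A′ B′ + k)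

  toEdge : (j k A B A′ B′ : ℕ) → ℕ
  toEdge j k A B A′ B′ =
    throughEnds j k A B A′ B′ ⊓
    (sel A B′ ∣ j - (η ∸ k) ∣ (throughEnds j k A B A′ B′) ⊓
     sel B A′ ∣ j - k ∣       (throughEnds j k A B A′ B′))

  toVertex-lipschitz : ∀ j {A B A′ B′} → A ≤ suc A′ → B ≤ suc B′ → toVertex j A B ≤ toVertex j A′ B′ + η
  toVertex-lipschitz j {A} {B} {A′} {B′} A≤ B≤ = ≤-trans
    (⊓-mono-≤ (branch j A≤) (branch (η ∸ j) B≤))
    (≤-reflexive (sym (+-distribʳ-⊓ η (j + A′ * η) ((η ∸ j) + B′ * η))))
    where
    branch : ∀ i {A A′} → A ≤ suc A′ → i + A * η ≤ (i + A′ * η) + η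
    branch i {A} {A′} A≤ = begin
      i + A * η         ≤⟨ +-monoʳ-≤ i (*-monoˡ-≤ η A≤) ⟩
      i + (η + A′ * η)  ≡⟨ cong (i +_) (+-comm η (A′ * η)) ⟩
      i + (A′ * η + η)  ≡⟨ sym (+-assoc i (A′ * η) η) ⟩
      (i + A′ * η) + η  ∎
      where open ≤-Reasoning

  -- Edges are stored in increasing order, whereas the robber walks them in both directions;
  -- measuring from the other end must not change the formula.
  toEdge-sym : ∀ j {k} A B A′ B′ → k ≤ η → toEdge j (η ∸ k) A′ B′ A B ≡ toEdge j k A B A′ B′
  toEdge-sym j {k} A B A′ B′ k≤η
    rewrite m∸[m∸n]≡n k≤η
          | ⊓-comm (toVertex j A′ B′ + k) (toVertex j A B + (η ∸ k))
          | sel-comm A′ B ∣ j - k ∣ (throughEnds j k A B A′ B′)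
          | sel-comm B′ A ∣ j - (η ∸ k) ∣ (throughEnds j k A B A′ B′)
    = cong (throughEnds j k A B A′ B′ ⊓_)
           (⊓-comm (sel B A′ ∣ j - k ∣ (throughEnds j k A B A′ B′)) _)

  ∸-step : ∀ k → η ∸ k ≤ suc (η ∸ suc k)
  ∸-step k = ≤-trans (m≤n+m∸n (η ∸ k) 1) (≤-reflexive (cong suc (trans (∸-+-assoc η k 1) (cong (η ∸_) (+-comm k 1)))))

  ∸-step′ : ∀ k → η ∸ suc k ≤ suc (η ∸ k)
  ∸-step′ k = m≤n⇒m≤1+n (∸-monoʳ-≤ η (n≤1+n k))

  +-step : ∀ a {x y} → x ≤ suc y → a + x ≤ suc (a + y)
  +-step a {x} {y} x≤ = ≤-trans (+-monoʳ-≤ a x≤) (≤-reflexive (+-suc a y))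

  toEdge-lipschitz : ∀ j {k k′} A B A′ B′ → k ≤ suc k′ → k′ ≤ suc k → η ∸ k ≤ suc (η ∸ k′) → η ∸ k′ ≤ suc (η ∸ k) →
                     toEdge j k A B A′ B′ ≤ suc (toEdge j k′ A B A′ B′)
  toEdge-lipschitz j {k} {k′} A B A′ B′ k≤ k′≤ i≤ i′≤ =
    ⊓-mono-≤ through (⊓-mono-≤ (sel-mono A B′ (∣-∣-lipschitz j i≤ i′≤) through)
                               (sel-mono B A′ (∣-∣-lipschitz j k≤ k′≤) through))
    where
    through : throughEnds j k A B A′ B′ ≤ suc (throughEnds j k′ A B A′ B′)
    through = ⊓-mono-≤ (+-step (toVertex j A B) i≤) (+-step (toVertex j A′ B′) k≤)

  toEdge-first : ∀ j {k} A B A′ B′ → η ∸ k ≤ 1 → toEdge j k A B A′ B′ ≤ suc (toVertex j A B)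
  toEdge-first j {k} A B A′ B′ i≤ =
    ≤-trans (m⊓n≤m _ _) (≤-trans (m⊓n≤m _ _) (≤-trans (+-step (toVertex j A B) i≤)
      (≤-reflexive (cong suc (+-identityʳ _)))))

  -- A route through `v` to the point next to `u` spends at least `η ∸ 1` steps on the edge, while
  -- `toVertex` differs by at most `η` between `u` and `v`.
  first-toEdge : ∀ j {k} A B A′ B′ → A ≤ suc A′ → B ≤ suc B′ → η ∸ k ≤ 1 → η ≤ suc k →
                 toVertex j A B ≤ suc (toEdge j k A B A′ B′)
  first-toEdge j {k} A B A′ B′ A≤ B≤ i≤ k≥ =
    ⊓-glb through (⊓-glb (sel-elim (λ m → toVertex j A B ≤ suc m) A B′ near through)
                         (sel-elim (λ m → toVertex j A B ≤ suc m) B A′ far through))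
    where
    open ≤-Reasoning
    through : toVertex j A B ≤ suc (throughEnds j k A B A′ B′)
    through = ⊓-glb (m≤n⇒m≤1+n (m≤m+n _ _)) (begin
      toVertex j A B          ≤⟨ toVertex-lipschitz j A≤ B≤ ⟩
      toVertex j A′ B′ + η    ≤⟨ +-step (toVertex j A′ B′) k≥ ⟩
      suc (toVertex j A′ B′ + k) ∎)
    near : A ≡ 0 → B′ ≡ 0 → toVertex j A B ≤ suc ∣ j - (η ∸ k) ∣
    near refl _ = begin
      toVertex j 0 B           ≤⟨ m⊓n≤m _ _ ⟩
      j + 0                    ≡⟨ +-identityʳ j ⟩
      j                        ≤⟨ m≤n+∣m-n∣ j (η ∸ k) ⟩
      (η ∸ k) + ∣ j - (η ∸ k) ∣ ≤⟨ +-monoˡ-≤ _ i≤ ⟩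
      suc ∣ j - (η ∸ k) ∣      ∎
    far : B ≡ 0 → A′ ≡ 0 → toVertex j A B ≤ suc ∣ j - k ∣
    far refl _ = begin
      toVertex j A 0           ≤⟨ m⊓n≤n (j + A * η) _ ⟩
      (η ∸ j) + 0              ≡⟨ +-identityʳ _ ⟩
      η ∸ j                    ≤⟨ ∸-monoˡ-≤ j k≥ ⟩
      suc k ∸ j                ≤⟨ m≤n+o⇒m∸n≤o (suc k) j (≤-trans (s≤s (m≤n+∣n-m∣ k j)) (≤-reflexive (sym (+-suc j _)))) ⟩
      suc ∣ j - k ∣            ∎

-- Distances in a subdivision

module SubdividedWalks {n : ℕ} (G : SimpleGraph n) where

  private
    s t : Edge G → Fin n
    s = src {G = G}
    t = tgt {G = G}

  edge-≡ : ∀ (e e′ : Edge G) → s e ≡ s e′ → t e ≡ t e′ → e ≡ e′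
  edge-≡ ((u , v) , (l , a)) (_ , (l′ , a′)) refl refl =
    cong₂ (λ x y → ((u , v) , (x , y))) (≤-irrelevant l l′) (Decidable⇒UIP.≡-irrelevant B._≟_ a a′)

  climb : ∀ {q} m {e e′} {i j : Fin q} → s e ≡ s e′ → t e ≡ t e′ → toℕ j ≡ m + toℕ i →
          Walk (subdivide G (suc q)) (inj₂ (e , i)) (inj₂ (e′ , j)) m
  climb zero {e} {e′} {i} {j} es et eq with edge-≡ e e′ es et | F.toℕ-injective eq
  ... | refl | refl = here _
  climb {q} (suc m) {e} {e′} {i} {j} es et eq =
    step (inj₁ (mid {e = e} {e' = e} {i = i} {j = i⁺} refl refl (F.toℕ-fromℕ< i⁺<q)))
         (climb m es et (trans eq (trans (sym (+-suc m (toℕ i))) (cong (m +_) (sym (F.toℕ-fromℕ< i⁺<q))))))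
    where
    i⁺<q : suc (toℕ i) < q
    i⁺<q = ≤-<-trans (≤-trans (s≤s (m≤n+m (toℕ i) m)) (≤-reflexive (sym eq))) (F.toℕ<n j)
    i⁺ : Fin q
    i⁺ = fromℕ< i⁺<q

  src⇝ : ∀ {q} e (i : Fin q) → Walk (subdivide G (suc q)) (inj₁ (s e)) (inj₂ (e , i)) (suc (toℕ i))
  src⇝ e i = step (inj₁ (start {e = e} (F.toℕ-fromℕ< 0<q)))
                  (climb (toℕ i) refl refl (trans (sym (+-identityʳ _)) (cong (toℕ i +_) (sym (F.toℕ-fromℕ< 0<q)))))
    where 0<q = ≤-<-trans z≤n (F.toℕ<n i)

  ⇝tgt : ∀ {q} e (i : Fin q) → Walk (subdivide G (suc q)) (inj₂ (e , i)) (inj₁ (t e)) (q ∸ toℕ i)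
  ⇝tgt {q} e i = subst (Walk _ _ _) (sym (∸-suc (F.toℕ<n i)))
    (snoc (climb (q ∸ suc (toℕ i)) {e = e} {e′ = e} refl refl (F.toℕ-fromℕ< last<q))
          (inj₁ (end {e = e} (trans (cong suc (F.toℕ-fromℕ< last<q)) last≡))))
    where
    last≡ : suc (q ∸ suc (toℕ i) + toℕ i) ≡ q
    last≡ = trans (sym (+-suc _ (toℕ i))) (m∸n+n≡m (F.toℕ<n i))
    last<q : q ∸ suc (toℕ i) + toℕ i < q
    last<q = ≤-reflexive last≡
    ∸-suc : ∀ {m n} → m < n → n ∸ m ≡ suc (n ∸ suc m)
    ∸-suc {zero}  {suc n} _        = refl
    ∸-suc {suc m} {suc n} (s≤s lt) = ∸-suc lt

  src⇝tgt : ∀ {q} e → Walk (subdivide G (suc q)) (inj₁ (s e)) (inj₁ (t e)) (suc q)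
  src⇝tgt {zero}  e@(_ , _ , a) = step (inj₁ (orig refl a)) (here _)
  src⇝tgt {suc q} e = src⇝ e Data.Fin.zero ++ʷ ⇝tgt e Data.Fin.zero

  adj⇒≢ : ∀ {u v} → adj G u v ≡ true → ¬ u ≡ v
  adj⇒≢ {u} a refl with trans (sym a) (irrefl G u)
  ... | ()

  subdivide-sym : ∀ {m x y} → _~_ (subdivide G m) x y → _~_ (subdivide G m) y x
  subdivide-sym = swap

  adj⇝ : ∀ {q u v} → adj G u v ≡ true → Walk (subdivide G (suc q)) (inj₁ u) (inj₁ v) (suc q)
  adj⇝ {q} {u} {v} a with F.<-cmp u v
  ... | tri< u<v _ _ = src⇝tgt ((u , v) , u<v , a)
  ... | tri≈ _ u≡v _ = ⊥-elim (adj⇒≢ a u≡v)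
  ... | tri> _ _ v<u = reverse subdivide-sym (src⇝tgt ((v , u) , v<u , trans (adj-sym G v u) a))

  lift : ∀ {q u v k} → Walk (toGraph G) u v k → Walk (subdivide G (suc q)) (inj₁ u) (inj₁ v) (k * suc q)
  lift (here u)   = here (inj₁ u)
  lift (step a w) = adj⇝ a ++ʷ lift w

module Distances {n : ℕ} (G : SimpleGraph n) (q : ℕ)
  (d : Fin n → Fin n → ℕ) (dist : ∀ u v → Dist (toGraph G) u v (d u v)) where

  open SubdividedWalks G

  η : ℕ
  η = suc q

  open Formula η public

  Hᴳ : Graph
  Hᴳ = subdivide G η

  Point : Set
  Point = SubV G η

  private
    s t : Edge G → Fin n
    s = src {G = G}
    t = tgt {G = G}

  d-refl : ∀ u → d u u ≡ 0
  d-refl u = Dist-unique (dist u u) (Dist-refl u)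

  d≡0⇒≡ : ∀ {u v} → d u v ≡ 0 → u ≡ v
  d≡0⇒≡ {u} {v} eq with d u v | dist u v | eq
  ... | .0 | here _ , _ | refl = refl

  d-step : ∀ a {u v} → adj G u v ≡ true → d a v ≤ suc (d a u)
  d-step a {u} {v} uv = proj₂ (dist a v) _ (snoc (proj₁ (dist a u)) uv)

  d-step′ : ∀ a {u v} → adj G u v ≡ true → d a u ≤ suc (d a v)
  d-step′ a {u} {v} uv = d-step a (trans (adj-sym G v u) uv)

  -- An original vertex counts as a point with offset 0 and both ends equal to itself; the second
  -- branch of `toVertex` then exceeds the first by `η` and never matters.
  endA endB : Point → Fin n
  endA (inj₁ a)       = a
  endA (inj₂ (e , _)) = s e
  endB (inj₁ a)       = a
  endB (inj₂ (e , _)) = t e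

  offset : Point → ℕ
  offset (inj₁ _)       = 0
  offset (inj₂ (_ , i)) = suc (toℕ i)

  vertexDist : Point → Fin n → ℕ
  vertexDist p v = toVertex (offset p) (d (endA p) v) (d (endB p) v)

  edgeDist : Point → (k : ℕ) → Fin n → Fin n → ℕ
  edgeDist p k u v = toEdge (offset p) k (d (endA p) u) (d (endB p) u) (d (endA p) v) (d (endB p) v)

  distH : Point → Point → ℕ
  distH p (inj₁ v)       = vertexDist p v
  -- The inner point `i` lies `suc (toℕ i)` steps after `s e`, hence `q ∸ toℕ i` steps before `t e`.
  distH p (inj₂ (e , i)) = edgeDist p (q ∸ toℕ i) (s e) (t e)

  η∸[q∸i] : ∀ (i : Fin q) → η ∸ (q ∸ toℕ i) ≡ suc (toℕ i)
  η∸[q∸i] i = trans (+-∸-assoc 1 (m∸n≤m q (toℕ i))) (cong suc (m∸[m∸n]≡n (<⇒≤ (F.toℕ<n i))))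

  private
    adjacent-ends : (e : Edge G) → adj G (s e) (t e) ≡ true
    adjacent-ends (_ , _ , a) = a

    vertex-lip : ∀ p {u v} → adj G u v ≡ true → vertexDist p v ≤ vertexDist p u + η
    vertex-lip p a = toVertex-lipschitz (offset p) (d-step (endA p) a) (d-step (endB p) a)

    step-lip : ∀ p {x y} → Step G η x y → distH p y ≤ suc (distH p x) × distH p x ≤ suc (distH p y)
    step-lip p (orig {u} {v} refl a) =
      ≤-trans (vertex-lip p a) (≤-reflexive (+-comm _ 1)) ,
      ≤-trans (vertex-lip p (trans (adj-sym G v u) a)) (≤-reflexive (+-comm _ 1))
    step-lip p (start {e} {i} i≡0) =
      toEdge-first (offset p) _ _ _ _ near ,
      first-toEdge (offset p) _ _ _ _
        (d-step′ (endA p) (adjacent-ends e)) (d-step′ (endB p) (adjacent-ends e)) near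
        (≤-reflexive (cong (λ m → suc (q ∸ m)) (sym i≡0)))
      where
      near : η ∸ (q ∸ toℕ i) ≤ 1
      near = ≤-reflexive (trans (η∸[q∸i] i) (cong suc i≡0))
    step-lip p (mid {e} {e'} {i} {j} es et j≡1+i) rewrite es | et =
      toEdge-lipschitz (offset p) _ _ _ _ k′≤ k≤ i′≤ i≤ , toEdge-lipschitz (offset p) _ _ _ _ k≤ k′≤ i≤ i′≤
      where
      k≤ : q ∸ toℕ i ≤ suc (q ∸ toℕ j)
      k≤ = subst (λ m → q ∸ toℕ i ≤ suc (q ∸ m)) (sym j≡1+i) (Formula.∸-step q (toℕ i))
      k′≤ : q ∸ toℕ j ≤ suc (q ∸ toℕ i)
      k′≤ = subst (λ m → q ∸ m ≤ suc (q ∸ toℕ i)) (sym j≡1+i) (Formula.∸-step′ q (toℕ i))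
      i≤ : η ∸ (q ∸ toℕ i) ≤ suc (η ∸ (q ∸ toℕ j))
      i≤ rewrite η∸[q∸i] i | η∸[q∸i] j | j≡1+i = s≤s (m≤n⇒m≤1+n (n≤1+n _))
      i′≤ : η ∸ (q ∸ toℕ j) ≤ suc (η ∸ (q ∸ toℕ i))
      i′≤ rewrite η∸[q∸i] i | η∸[q∸i] j | j≡1+i = ≤-refl
    -- Seen from `t e`, the last inner point is the first one; reversing the edge reduces this case
    -- to the bounds used for `start`.
    step-lip p (end {e} {i} 1+i≡q) =
      subst (λ m → vertexDist p (t e) ≤ suc m) flip
        (first-toEdge (offset p) _ _ _ _ (d-step (endA p) (adjacent-ends e)) (d-step (endB p) (adjacent-ends e)) near far) ,
      subst (λ m → m ≤ suc (vertexDist p (t e))) flip (toEdge-first (offset p) _ _ _ _ near)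
      where
      k≡1 : q ∸ toℕ i ≡ 1
      k≡1 = trans (cong (_∸ toℕ i) (sym 1+i≡q)) (m+n∸n≡m 1 (toℕ i))
      k≤η : q ∸ toℕ i ≤ η
      k≤η = m≤n⇒m≤1+n (m∸n≤m q (toℕ i))
      near : η ∸ (η ∸ (q ∸ toℕ i)) ≤ 1
      near = ≤-reflexive (trans (m∸[m∸n]≡n k≤η) k≡1)
      far : η ≤ suc (η ∸ (q ∸ toℕ i))
      far rewrite k≡1 = ≤-refl
      flip : edgeDist p (η ∸ (q ∸ toℕ i)) (t e) (s e) ≡ edgeDist p (q ∸ toℕ i) (s e) (t e)
      flip = toEdge-sym (offset p) _ _ _ _ k≤η

    distH-lip : ∀ p {x y} → _~_ Hᴳ x y → distH p y ≤ suc (distH p x)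
    distH-lip p (inj₁ st) = proj₁ (step-lip p st)
    distH-lip p (inj₂ st) = proj₂ (step-lip p st)

    distH-self : ∀ p → distH p p ≤ 0
    distH-self (inj₁ v) rewrite d-refl v = z≤n
    distH-self (inj₂ (e , i)) = ≤-trans (m⊓n≤n _ _) (≤-trans (m⊓n≤m _ _) same)
      where
      same : sel (d (s e) (s e)) (d (t e) (t e)) ∣ suc (toℕ i) - (η ∸ (q ∸ toℕ i)) ∣ _ ≤ 0
      same rewrite d-refl (s e) | d-refl (t e) | η∸[q∸i] i | ∣n-n∣≡0 (toℕ i) = z≤n

    ⇝vertex : ∀ p v → Walk Hᴳ p (inj₁ v) (vertexDist p v)
    ⇝vertex (inj₁ a) v = subst (Walk Hᴳ _ _) (sym (m≤n⇒m⊓n≡m (m≤n+m _ η))) (lift (proj₁ (dist a v)))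
    ⇝vertex (inj₂ (e , i)) v = ⊓-walk
      (reverse subdivide-sym (src⇝ e i) ++ʷ lift (proj₁ (dist (s e) v)))
      (⇝tgt e i ++ʷ lift (proj₁ (dist (t e) v)))

    ends-ordered : (e : Edge G) → s e Data.Fin.< t e
    ends-ordered (_ , lt , _) = lt

    ⇝same-edge : ∀ p e i → d (endA p) (s e) ≡ 0 → d (endB p) (t e) ≡ 0 →
                 Walk Hᴳ p (inj₂ (e , i)) ∣ offset p - (η ∸ (q ∸ toℕ i)) ∣
    ⇝same-edge (inj₁ a) e i a≡s a≡t =
      ⊥-elim (F.<-irrefl (trans (sym (d≡0⇒≡ a≡s)) (d≡0⇒≡ a≡t)) (ends-ordered e))
    ⇝same-edge (inj₂ (e′ , j)) e i es et rewrite η∸[q∸i] i with ≤-total (toℕ j) (toℕ i)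
    ... | inj₁ j≤i = subst (Walk Hᴳ _ _) (sym (m≤n⇒∣m-n∣≡n∸m j≤i))
                       (climb _ (d≡0⇒≡ es) (d≡0⇒≡ et) (sym (m∸n+n≡m j≤i)))
    ... | inj₂ i≤j = subst (Walk Hᴳ _ _) (sym (m≤n⇒∣n-m∣≡n∸m i≤j))
                       (reverse subdivide-sym (climb _ (sym (d≡0⇒≡ es)) (sym (d≡0⇒≡ et)) (sym (m∸n+n≡m i≤j))))

    endA≤endB : ∀ p → toℕ (endA p) ≤ toℕ (endB p)
    endA≤endB (inj₁ _)       = ≤-refl
    endA≤endB (inj₂ (e , _)) = <⇒≤ (ends-ordered e)

    ⇝ : ∀ p x → Walk Hᴳ p x (distH p x)
    ⇝ p (inj₁ v) = ⇝vertex p v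
    ⇝ p (inj₂ (e , i)) =
      ⊓-walk through (⊓-walk (sel-elim (Walk Hᴳ _ _) (d (endA p) (s e)) _ (⇝same-edge p e i) through)
                             (sel-elim (Walk Hᴳ _ _) (d (endB p) (s e)) _ reversed through))
      where
      through : Walk Hᴳ p (inj₂ (e , i)) (throughEnds (offset p) (q ∸ toℕ i) (d (endA p) (s e)) (d (endB p) (s e)) (d (endA p) (t e)) (d (endB p) (t e)))
      through = ⊓-walk (⇝vertex p (s e) ++ʷ subst (Walk Hᴳ _ _) (sym (η∸[q∸i] i)) (src⇝ e i))
                       (⇝vertex p (t e) ++ʷ reverse subdivide-sym (⇝tgt e i))
      -- Since `s e` is smaller than `t e` for every stored edge, `p` cannot lie on the same edge in
      -- the opposite orientation.
      reversed : ∀ {k} → d (endB p) (s e) ≡ 0 → d (endA p) (t e) ≡ 0 → Walk Hᴳ p (inj₂ (e , i)) k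
      reversed b≡s a≡t = ⊥-elim (<⇒≱ (ends-ordered e)
        (subst₂ (λ x y → toℕ x ≤ toℕ y) (d≡0⇒≡ a≡t) (d≡0⇒≡ b≡s) (endA≤endB p)))

  -- The formula is the length of an actual walk, and as a 1-Lipschitz function vanishing at `p` it
  -- bounds every walk from below.
  Dist-distH : ∀ p x → Dist Hᴳ p x (distH p x)
  Dist-distH p x = ⇝ p x , λ k w → ≤-trans (lipschitz-walk (distH p) (distH-lip p) w) (+-monoˡ-≤ k (distH-self p))

-- The possible answers to a probe

⊓-elim : (P : ℕ → Set) → ∀ {a b} → P a → P b → P (a ⊓ b)
⊓-elim P {a} {b} pa pb with ⊓-sel a b
... | inj₁ eq = subst P (sym eq) pa
... | inj₂ eq = subst P (sym eq) pb

module Answers (η : ℕ) where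

  open Formula η

  toEdge-elim : (P : ℕ → Set) → ∀ j k A B A′ B′ → P (throughEnds j k A B A′ B′) →
                (A ≡ 0 → P ∣ j - (η ∸ k) ∣) → (B ≡ 0 → P ∣ j - k ∣) → P (toEdge j k A B A′ B′)
  toEdge-elim P j k A B A′ B′ through near far =
    ⊓-elim P through (⊓-elim P (sel-elim P A B′ (λ A≡0 _ → near A≡0) through)
                               (sel-elim P B A′ (λ B≡0 _ → far B≡0) through))

  -- If the end of `p` is at distance `suc c` from `u`, then `v` may be one closer to it. At
  -- distance 0 nothing is closer, and only then can the distance along a common edge occur; the two
  -- cases share a slot, which keeps `nearAnswers` at five entries.
  closer : (i k same : ℕ) → ℕ → ℕ
  closer i k same zero    = same
  closer i k same (suc c) = (i + c * η) + k

  nearAnswers : (j k A B : ℕ) → List ℕ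
  nearAnswers j k A B =
    (toVertex j A B + (η ∸ k)) ∷
    closer j k ∣ j - (η ∸ k) ∣ A ∷ ((j + A * η) + k) ∷
    closer (η ∸ j) k ∣ j - k ∣ B ∷ (((η ∸ j) + B * η) + k) ∷ []

  toEdge∈nearAnswers : ∀ j k A B A′ B′ → A ≤ suc A′ → A′ ≤ suc A → B ≤ suc B′ → B′ ≤ suc B →
                       toEdge j k A B A′ B′ ∈ nearAnswers j k A B
  toEdge∈nearAnswers j k A B A′ B′ A≤ A′≤ B≤ B′≤ =
    toEdge-elim (_∈ nearAnswers j k A B) j k A B A′ B′ through∈
      (λ { refl → there (here refl) }) (λ { refl → there (there (there (here refl))) })
    where
    back : ℕ
    back = toVertex j A B + (η ∸ k)

    through : ℕ
    through = throughEnds j k A B A′ B′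

    -- Going on to an end that is farther from p than the previous one never beats turning back.
    back≤ : ∀ i C → toVertex j A B ≤ i + C * η → back ≤ (i + suc C * η) + k
    back≤ i C ≤C = begin
      toVertex j A B + (η ∸ k) ≤⟨ +-mono-≤ ≤C (m∸n≤m η k) ⟩
      (i + C * η) + η          ≡⟨ +-assoc i (C * η) η ⟩
      i + (C * η + η)          ≡⟨ cong (i +_) (+-comm (C * η) η) ⟩
      i + (η + C * η)          ≤⟨ m≤m+n _ k ⟩
      (i + suc C * η) + k      ∎
      where open ≤-Reasoning

    data Onward (i C same : ℕ) : Set where
      same-distance : through ≡ (i + C * η) + k → Onward i C same
      one-closer    : through ≡ closer i k same C → Onward i C same
      turn-back     : through ≡ back → Onward i C same

    onward : ∀ i C C′ same → C ≤ suc C′ → C′ ≤ suc C → toVertex j A B ≤ i + C * η →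
             through ≡ (i + C′ * η) + k → Onward i C same
    onward i C C′ same C≤ C′≤ ≤C eq with <-cmp C C′
    ... | tri≈ _ refl _ = same-distance eq
    ... | tri< C<C′ _ _ with ≤-antisym C′≤ C<C′
    ...   | refl = turn-back (≤-antisym (m⊓n≤m back _) (≤-trans (back≤ i C ≤C) (≤-reflexive (sym eq))))
    onward i C C′ same C≤ C′≤ ≤C eq | tri> _ _ C′<C with ≤-antisym C≤ C′<C
    ...   | refl = one-closer eq

    through∈ : through ∈ nearAnswers j k A B
    through∈ with ⊓-sel back (toVertex j A′ B′ + k)
    ... | inj₁ eq = here eq
    ... | inj₂ eq with ⊓-sel (j + A′ * η) ((η ∸ j) + B′ * η)
    ...   | inj₁ eqA with onward j A A′ ∣ j - (η ∸ k) ∣ A≤ A′≤ (m⊓n≤m _ _) (trans eq (cong (_+ k) eqA))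
    ...     | same-distance e = there (there (here e))
    ...     | one-closer e    = there (here e)
    ...     | turn-back e     = here e
    through∈ | inj₂ eq | inj₂ eqB
      with onward (η ∸ j) B B′ ∣ j - k ∣ B≤ B′≤ (m⊓n≤n (j + A * η) _) (trans eq (cong (_+ k) eqB))
    ...     | same-distance e = there (there (there (there (here e))))
    ...     | one-closer e    = there (there (there (here e)))
    ...     | turn-back e     = here e

  module _ (δ : ℕ) where

    vertexAnswers : ℕ → List ℕ
    vertexAnswers j = map (λ X → j + X * η) (upTo (suc δ)) ++ map (λ X → (η ∸ j) + X * η) (upTo (suc δ))

    toVertex∈vertexAnswers : ∀ j {A B} → A ≤ δ → B ≤ δ → toVertex j A B ∈ vertexAnswers j
    toVertex∈vertexAnswers j A≤ B≤ = ⊓-elim (_∈ vertexAnswers j)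
      (∈-++⁺ˡ (∈-map⁺ (λ X → j + X * η) (∈-upTo⁺ (s≤s A≤))))
      (∈-++⁺ʳ (map (λ X → j + X * η) (upTo (suc δ))) (∈-map⁺ (λ X → (η ∸ j) + X * η) (∈-upTo⁺ (s≤s B≤))))

    belowTop : (ℕ → ℕ) → List ℕ
    belowTop f = map f (upTo δ)

    -- The four families combine an end of `p` with an end of the edge. Length `δ` is left out of
    -- each of them, since it can only produce the third entry.
    farAnswers : (j k : ℕ) → List ℕ
    farAnswers j k =
      ∣ j - (η ∸ k) ∣ ∷ ∣ j - k ∣ ∷ throughEnds j k δ δ δ δ ∷
      belowTop (λ X → (j + X * η) + (η ∸ k)) ++ belowTop (λ X → ((η ∸ j) + X * η) + (η ∸ k)) ++
      belowTop (λ X → (j + X * η) + k) ++ belowTop (λ X → ((η ∸ j) + X * η) + k)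

    toEdge∈farAnswers : ∀ j k {A B A′ B′} → A ≤ δ → B ≤ δ → A′ ≤ δ → B′ ≤ δ →
                        toEdge j k A B A′ B′ ∈ farAnswers j k
    toEdge∈farAnswers j k {A} {B} {A′} {B′} A≤ B≤ A′≤ B′≤ =
      toEdge-elim (_∈ farAnswers j k) j k A B A′ B′ (there (there through∈)) (λ _ → here refl) (λ _ → there (here refl))
      where
      through top : ℕ
      through = throughEnds j k A B A′ B′
      top     = throughEnds j k δ δ δ δ

      toVertex≤ : ∀ {A B} → A ≤ δ → B ≤ δ → toVertex j A B ≤ toVertex j δ δ
      toVertex≤ A≤ B≤ = ⊓-mono-≤ (+-monoʳ-≤ j (*-monoˡ-≤ η A≤)) (+-monoʳ-≤ (η ∸ j) (*-monoˡ-≤ η B≤))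

      through≤top : through ≤ top
      through≤top = ⊓-mono-≤ (+-monoˡ-≤ (η ∸ k) (toVertex≤ A≤ B≤)) (+-monoˡ-≤ k (toVertex≤ A′≤ B′≤))

      top≤₁ : top ≤ toVertex j δ δ + (η ∸ k)
      top≤₁ = m⊓n≤m _ _

      top≤₂ : top ≤ toVertex j δ δ + k
      top≤₂ = m⊓n≤n (toVertex j δ δ + (η ∸ k)) _

      -- A route of maximal length δ is only ever a shortest one if it attains the common bound top.
      place : ∀ (f : ℕ → ℕ) {X L} → X ≤ δ → top ≤ f δ → through ≡ f X →
              (∀ {m} → m ∈ belowTop f → m ∈ L) → through ∈ top ∷ L
      place f X≤ top≤ eq inL with m≤n⇒m<n∨m≡n X≤
      ... | inj₁ X<δ  = there (inL (subst (_∈ belowTop f) (sym eq) (∈-map⁺ f (∈-upTo⁺ X<δ))))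
      ... | inj₂ refl = here (≤-antisym through≤top (≤-trans top≤ (≤-reflexive (sym eq))))

      through∈ : through ∈ top ∷ _
      through∈ with ⊓-sel (toVertex j A B + (η ∸ k)) (toVertex j A′ B′ + k)
      through∈ | inj₁ eq with ⊓-sel (j + A * η) ((η ∸ j) + B * η)
      ... | inj₁ e = place (λ X → (j + X * η) + (η ∸ k)) A≤ (≤-trans top≤₁ (+-monoˡ-≤ (η ∸ k) (m⊓n≤m _ _)))
                       (trans eq (cong (_+ (η ∸ k)) e)) ∈-++⁺ˡ
      ... | inj₂ e = place (λ X → ((η ∸ j) + X * η) + (η ∸ k)) B≤ (≤-trans top≤₁ (+-monoˡ-≤ (η ∸ k) (m⊓n≤n (j + δ * η) _)))
                       (trans eq (cong (_+ (η ∸ k)) e)) (λ x → ∈-++⁺ʳ (belowTop _) (∈-++⁺ˡ x))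
      through∈ | inj₂ eq with ⊓-sel (j + A′ * η) ((η ∸ j) + B′ * η)
      ... | inj₁ e = place (λ X → (j + X * η) + k) A′≤ (≤-trans top≤₂ (+-monoˡ-≤ k (m⊓n≤m _ _)))
                       (trans eq (cong (_+ k) e)) (λ x → ∈-++⁺ʳ (belowTop _) (∈-++⁺ʳ (belowTop _) (∈-++⁺ˡ x)))
      ... | inj₂ e = place (λ X → ((η ∸ j) + X * η) + k) B′≤ (≤-trans top≤₂ (+-monoˡ-≤ k (m⊓n≤n (j + δ * η) _)))
                       (trans eq (cong (_+ k) e)) (λ x → ∈-++⁺ʳ (belowTop _) (∈-++⁺ʳ (belowTop _) (∈-++⁺ʳ (belowTop _) x)))

    length-map-upTo : ∀ (f : ℕ → ℕ) m → length (map f (upTo m)) ≡ m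
    length-map-upTo f m = trans (length-map f (upTo m)) (length-upTo m)

    length-farAnswers : ∀ j k → length (farAnswers j k) ≤ 4 * δ + 3
    length-farAnswers j k
      rewrite length-++ (belowTop (λ X → (j + X * η) + (η ∸ k)))
                {belowTop (λ X → ((η ∸ j) + X * η) + (η ∸ k)) ++ belowTop (λ X → (j + X * η) + k) ++ belowTop (λ X → ((η ∸ j) + X * η) + k)}
            | length-++ (belowTop (λ X → ((η ∸ j) + X * η) + (η ∸ k)))
                {belowTop (λ X → (j + X * η) + k) ++ belowTop (λ X → ((η ∸ j) + X * η) + k)}
            | length-++ (belowTop (λ X → (j + X * η) + k)) {belowTop (λ X → ((η ∸ j) + X * η) + k)}
            | length-map-upTo (λ X → (j + X * η) + (η ∸ k)) δ
            | length-map-upTo (λ X → ((η ∸ j) + X * η) + (η ∸ k)) δ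
            | length-map-upTo (λ X → (j + X * η) + k) δ
            | length-map-upTo (λ X → ((η ∸ j) + X * η) + k) δ
      = ≤-reflexive (trans (+-comm 3 _) (cong (λ m → δ + (δ + (δ + m)) + 3) (sym (+-identityʳ δ))))

    length-vertexAnswers : ∀ j → length (vertexAnswers j) ≤ 4 * δ + 3
    length-vertexAnswers j = begin
      length (vertexAnswers j)        ≡⟨ length-++ viaA ⟩
      length viaA + length viaB       ≡⟨ cong₂ _+_ (length-map-upTo (λ X → j + X * η) (suc δ))
                                                   (length-map-upTo (λ X → (η ∸ j) + X * η) (suc δ)) ⟩
      suc δ + suc δ                   ≡⟨ cong suc (+-suc δ δ) ⟩
      2 + (δ + δ)                     ≤⟨ +-mono-≤ (n≤1+n 2) (+-monoʳ-≤ δ (m≤m+n δ _)) ⟩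
      3 + 4 * δ                       ≡⟨ +-comm 3 (4 * δ) ⟩
      4 * δ + 3                       ∎
      where
      open ≤-Reasoning
      viaA viaB : List ℕ
      viaA = map (λ X → j + X * η) (upTo (suc δ))
      viaB = map (λ X → (η ∸ j) + X * η) (upTo (suc δ))

-- Strategies of a single cop on the subdivision

module Simulation {n : ℕ} (G : SimpleGraph n) (q : ℕ)
  (d : Fin n → Fin n → ℕ) (dist : ∀ u v → Dist (toGraph G) u v (d u v)) where

  open SubdividedWalks G public
  open Distances G q d dist public

  infix 4 _⇢_

  _⇢_ : Fin n → Fin n → Set
  u ⇢ v = u ≡ v ⊎ adj G u v ≡ true

  _⇢?_ : ∀ u v → Dec (u ⇢ v)
  u ⇢? v = (u F.≟ v) ⊎-dec (adj G u v B.≟ true)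

  q∸[1+k]<q : ∀ {k} → suc k ≤ q → q ∸ suc k < q
  q∸[1+k]<q le = ∸-monoʳ-< z<s le

  -- The point at distance k from v on the path replacing the edge uv, for k ≤ q; junk (v itself)
  -- unless u and v are adjacent.
  point : ℕ → Fin n → Fin n → Point
  point zero    u v = inj₁ v
  point (suc k) u v with suc k ≤? q | adj G u v B.≟ true | F.<-cmp u v
  ... | yes k<q | yes a | tri< u<v _ _ = inj₂ (((u , v) , u<v , a) , fromℕ< (q∸[1+k]<q k<q))
  ... | yes k<q | yes a | tri> _ _ v<u = inj₂ (((v , u) , v<u , trans (adj-sym G v u) a) , fromℕ< k<q)
  ... | _       | _     | _            = inj₁ v

  -- With this junk value a robber staying put is a walk from `v` to itself, so both motions are
  -- treated alike.
  point-stay : ∀ k v → point k v v ≡ inj₁ v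
  point-stay zero    v = refl
  point-stay (suc k) v with suc k ≤? q | adj G v v B.≟ true | F.<-cmp v v
  ... | yes _ | yes a | tri< _ _ _ = ⊥-elim (adj⇒≢ a refl)
  ... | yes _ | yes a | tri> _ _ _ = ⊥-elim (adj⇒≢ a refl)
  ... | yes _ | yes _ | tri≈ _ _ _ = refl
  ... | yes _ | no _  | _ = refl
  ... | no _  | _     | _ = refl

  -- Hence probing both ends of a named point includes probing the vertex the robber is heading for.
  point-end : ∀ k u v → endA (point k u v) ≡ v ⊎ endB (point k u v) ≡ v
  point-end zero    u v = inj₁ refl
  point-end (suc k) u v with suc k ≤? q | adj G u v B.≟ true | F.<-cmp u v
  ... | yes _ | yes _ | tri< _ _ _ = inj₂ refl
  ... | yes _ | yes _ | tri> _ _ _ = inj₁ refl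
  ... | yes _ | yes _ | tri≈ _ _ _ = inj₁ refl
  ... | yes _ | no _  | _ = inj₁ refl
  ... | no _  | _     | _ = inj₁ refl

  point-ends : ∀ k u v {w} → endA (point k u v) ≡ w ⊎ endB (point k u v) ≡ w → w ≡ u ⊎ w ≡ v
  point-ends zero    u v (inj₁ eq) = inj₂ (sym eq)
  point-ends zero    u v (inj₂ eq) = inj₂ (sym eq)
  point-ends (suc k) u v with suc k ≤? q | adj G u v B.≟ true | F.<-cmp u v
  ... | yes _ | yes _ | tri< _ _ _ = λ { (inj₁ eq) → inj₁ (sym eq) ; (inj₂ eq) → inj₂ (sym eq) }
  ... | yes _ | yes _ | tri> _ _ _ = λ { (inj₁ eq) → inj₂ (sym eq) ; (inj₂ eq) → inj₁ (sym eq) }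
  ... | yes _ | yes _ | tri≈ _ _ _ = λ { (inj₁ eq) → inj₂ (sym eq) ; (inj₂ eq) → inj₂ (sym eq) }
  ... | yes _ | no _  | _ = λ { (inj₁ eq) → inj₂ (sym eq) ; (inj₂ eq) → inj₂ (sym eq) }
  ... | no _  | _     | _ = λ { (inj₁ eq) → inj₂ (sym eq) ; (inj₂ eq) → inj₂ (sym eq) }

  distH-point : ∀ p {k u v} → suc k ≤ q → adj G u v ≡ true → distH p (point (suc k) u v) ≡ edgeDist p (suc k) u v
  distH-point p {k} {u} {v} le a with suc k ≤? q | adj G u v B.≟ true | F.<-cmp u v
  ... | yes k<q | yes _ | tri< _ _ _ = cong (λ m → edgeDist p m u v)
          (trans (cong (q ∸_) (F.toℕ-fromℕ< (q∸[1+k]<q k<q))) (m∸[m∸n]≡n k<q))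
  ... | yes k<q | yes _ | tri> _ _ _ = trans (cong (λ m → edgeDist p (q ∸ m) v u) (F.toℕ-fromℕ< k<q))
          (toEdge-sym (offset p) _ _ _ _ (m≤n⇒m≤1+n le))
  ... | yes _ | yes a′ | tri≈ _ u≡v _ = ⊥-elim (adj⇒≢ a′ u≡v)
  ... | yes _ | no ¬a  | _ = ⊥-elim (¬a a)
  ... | no ¬k | _      | _ = ⊥-elim (¬k le)

  point-advance : ∀ {k u v} → suc k ≤ q → u ⇢ v → point (suc k) u v ≡ point k u v ⊎ _~_ Hᴳ (point (suc k) u v) (point k u v)
  point-advance {k} {u} le (inj₁ refl) = inj₁ (trans (point-stay (suc k) u) (sym (point-stay k u)))
  point-advance {zero} {u} {v} le (inj₂ a) with 1 ≤? q | adj G u v B.≟ true | F.<-cmp u v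
  ... | yes k<q | yes a | tri< u<v _ _ = inj₂ (inj₁ (end
          (trans (cong suc (F.toℕ-fromℕ< (q∸[1+k]<q k<q))) (m+[n∸m]≡n le))))
  ... | yes k<q | yes a | tri> _ _ v<u = inj₂ (inj₂ (start (F.toℕ-fromℕ< k<q)))
  ... | yes _ | yes a′ | tri≈ _ u≡v _ = ⊥-elim (adj⇒≢ a′ u≡v)
  ... | yes _ | no ¬a  | _ = ⊥-elim (¬a a)
  ... | no ¬k | _      | _ = ⊥-elim (¬k le)
  point-advance {suc k} {u} {v} le (inj₂ a) with suc (suc k) ≤? q | suc k ≤? q | adj G u v B.≟ true | F.<-cmp u v
  ... | yes k<q | yes k′<q | yes a | tri< u<v _ _ = inj₂ (inj₁ (mid refl refl
          (trans (F.toℕ-fromℕ< (q∸[1+k]<q k′<q)) (trans (+-∸-assoc 1 k<q) (cong suc (sym (F.toℕ-fromℕ< (q∸[1+k]<q k<q))))))))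
  ... | yes k<q | yes k′<q | yes a | tri> _ _ v<u = inj₂ (inj₂ (mid refl refl
          (trans (F.toℕ-fromℕ< k<q) (cong suc (sym (F.toℕ-fromℕ< k′<q))))))
  ... | yes _ | yes _ | yes a′ | tri≈ _ u≡v _ = ⊥-elim (adj⇒≢ a′ u≡v)
  ... | yes _ | yes _ | no ¬a  | _ = ⊥-elim (¬a a)
  ... | yes _ | no ¬k | _      | _ = ⊥-elim (¬k (<⇒≤ le))
  ... | no ¬k | _     | _      | _ = ⊥-elim (¬k le)

  point-depart : ∀ {u v} → u ⇢ v → inj₁ u ≡ point q u v ⊎ _~_ Hᴳ (inj₁ u) (point q u v)
  point-depart {u} (inj₁ refl) = inj₁ (sym (point-stay q u))
  -- `q` is replaced by a variable `k` for the case split, while the tests inside `point` still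
  -- refer to `q`.
  point-depart {u} {v} (inj₂ a) = depart q refl
    where
    depart : ∀ k → k ≡ q → inj₁ u ≡ point k u v ⊎ _~_ Hᴳ (inj₁ u) (point k u v)
    depart zero    eq = inj₂ (inj₁ (orig (cong suc (sym eq)) a))
    depart (suc k) eq with suc k ≤? q | adj G u v B.≟ true | F.<-cmp u v
    ... | yes k<q | yes a | tri< u<v _ _ = inj₂ (inj₁ (start
            (trans (F.toℕ-fromℕ< (q∸[1+k]<q k<q)) (trans (cong (_∸ suc k) (sym eq)) (n∸n≡0 k)))))
    ... | yes k<q | yes a | tri> _ _ v<u = inj₂ (inj₂ (end (trans (cong suc (F.toℕ-fromℕ< k<q)) eq)))
    ... | yes _ | yes a′ | tri≈ _ u≡v _ = ⊥-elim (adj⇒≢ a′ u≡v)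
    ... | yes _ | no ¬a  | _ = ⊥-elim (¬a a)
    ... | no ¬k | _      | _ = ⊥-elim (¬k (≤-reflexive eq))

  infixr 5 _▹_

  -- In each round the cop probes a point and, depending on the answer, names a point at which she
  -- claims the robber to be.
  data Strategy : ℕ → Set where
    done : Strategy 0
    _▹_  : ∀ {r} → Point → (ℕ → Point × Strategy r) → Strategy (suc r)

  -- σ names the position of a robber who is k steps before v on his way from u, whatever he does next.
  mutual
    Sure : ∀ {r} → Strategy r → (k : ℕ) → Fin n → Fin n → Set
    Sure done    k u v = ⊥
    Sure (p ▹ f) k u v = point k u v ≡ proj₁ (f (distH p (point k u v))) ⊎
                         SureNext (proj₂ (f (distH p (point k u v)))) k u v

    -- At `k = 0` the robber is at `v`; one round later he is `q` steps before his next vertex, so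
    -- every edge takes `suc q` rounds.
    SureNext : ∀ {r} → Strategy r → (k : ℕ) → Fin n → Fin n → Set
    SureNext σ (suc k) u v = Sure σ k u v
    SureNext σ zero    u v = ∀ w → v ⇢ w → Sure σ q v w

  module _ (o : Fin n) where

    idle : ∀ r → Strategy r
    idle zero    = done
    idle (suc r) = inj₁ o ▹ const (inj₁ o , idle r)

    -- The decidable relation `P` describes those robbers in `S` that walk at constant pace. Being
    -- finite, it can be searched, which turns the winning condition on sets into a function of the
    -- answers. The extra round is for naming a position that is already known.
    extract : ∀ r k → k ≤ q → (S : Point → Set) (P : Fin n → Fin n → Set) → (∀ u v → Dec (P u v)) →
              (∀ {u v} → P u v → u ⇢ v × S (point k u v)) → WinIn Hᴳ 1 r S →
              Σ (Strategy (suc r)) λ σ → ∀ {u v} → P u v → Sure σ k u v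
    extract r k k≤q S P P? P⇒S = build r
      where
      name-only : ∀ r → AtMostOne S → Σ (Strategy (suc r)) λ σ → ∀ {u v} → P u v → Sure σ k u v
      name-only r one with F.any? (λ u → F.any? (λ v → P? u v))
      ... | yes (u′ , v′ , P′) = (inj₁ o ▹ const (point k u′ v′ , idle r)) ,
                                 λ Puv → inj₁ (one _ _ (proj₂ (P⇒S Puv)) (proj₂ (P⇒S P′)))
      ... | no none            = idle (suc r) , λ Puv → ⊥-elim (none (_ , _ , Puv))

      build : ∀ r → WinIn Hᴳ 1 r S → Σ (Strategy (suc r)) λ σ → ∀ {u v} → P u v → Sure σ k u v
      build zero    one        = name-only zero one
      build (suc r) (inj₁ one) = name-only (suc r) one
      build (suc r) (inj₂ (probe , win)) = (p ▹ λ a → proj₁ (answer a)) , λ Puv → proj₂ (answer _) Puv refl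
        where
        p : Point
        p = probe Data.Fin.zero

        answer : ∀ a → Σ (Point × Strategy (suc r)) λ c → ∀ {u v} → P u v → distH p (point k u v) ≡ a →
                   point k u v ≡ proj₁ c ⊎ SureNext (proj₂ c) k u v
        answer a with F.any? (λ u → F.any? (λ v → P? u v ×-dec (distH p (point k u v) ≟ a)))
        ... | no none = (inj₁ o , idle (suc r)) , λ Puv eq → ⊥-elim (none (_ , _ , Puv , eq))
        -- `WinIn` asks for a position that gives the answer `a`; any pair found by the search will
        -- do.
        ... | yes (u′ , v′ , P′ , eq′) with win (point k u′ v′) (proj₂ (P⇒S P′))
        ...   | inj₁ one = (point k u′ v′ , idle (suc r)) ,
                  λ Puv eq → inj₁ (one _ _ (consistent Puv eq) (consistent P′ eq′))
          where
          consistent : ∀ {u v} → P u v → distH p (point k u v) ≡ a →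
                       S (point k u v) × (∀ j → SameAnswer Hᴳ (probe j) (point k u′ v′) (point k u v))
          consistent Puv eq = proj₂ (P⇒S Puv) ,
            λ { Data.Fin.zero → ≡⇒sameAnswer Dist-distH (trans eq′ (sym eq)) }
        ...   | inj₂ rest = continue k k≤q refl
          where
          S⁺ : Point → Set
          S⁺ = ClosedNbhd Hᴳ (λ y → S y × (∀ j → SameAnswer Hᴳ (probe j) (point k u′ v′) y))
          consistent : ∀ {u v} → P u v → distH p (point k u v) ≡ a →
                       S (point k u v) × (∀ j → SameAnswer Hᴳ (probe j) (point k u′ v′) (point k u v))
          consistent Puv eq = proj₂ (P⇒S Puv) ,
            λ { Data.Fin.zero → ≡⇒sameAnswer Dist-distH (trans eq′ (sym eq)) }
          continue : ∀ k′ → k′ ≤ q → k′ ≡ k → Σ (Point × Strategy (suc r)) λ c → ∀ {u v} → P u v →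
                     distH p (point k u v) ≡ a → point k u v ≡ proj₁ c ⊎ SureNext (proj₂ c) k u v
          continue (suc k′) k′<q refl =
            let σ , sure = extract r k′ (<⇒≤ k′<q) S⁺ (λ u v → P u v × distH p (point k u v) ≡ a)
                             (λ u v → P? u v ×-dec (distH p (point k u v) ≟ a))
                             (λ (Puv , eq) → let u⇢v = proj₁ (P⇒S Puv) in
                                u⇢v , _ , consistent Puv eq , point-advance k′<q u⇢v)
                             rest
            -- Nothing is known yet, so the name `inj₁ o` is arbitrary; the correct name comes from
            -- `σ`.
            in (inj₁ o , σ) , λ Puv eq → inj₂ (sure (Puv , eq))
          continue zero _ refl =
            -- A new edge begins at `v`: of the previous vertex `u` only its existence is
            -- remembered.
            let σ , sure = extract r q ≤-refl S⁺ (λ v w → v ⇢ w × ∃ λ u → P u v × distH p (inj₁ v) ≡ a)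
                             (λ v w → (v ⇢? w) ×-dec F.any? (λ u → P? u v ×-dec (distH p (inj₁ v) ≟ a)))
                             (λ (v⇢w , u , Puv , eq) → v⇢w , _ , consistent Puv eq , point-depart v⇢w)
                             rest
            in (inj₁ o , σ) , λ Puv eq → inj₂ (λ w v⇢w → sure (v⇢w , _ , Puv , eq))

-- Simulating a strategy on the original graph

length-concatMap-≤ : ∀ {A B : Set} (f : A → List B) {c} → (∀ a → length (f a) ≤ c) →
                     ∀ xs → length (concatMap f xs) ≤ length xs * c
length-concatMap-≤ f f≤ []       = z≤n
length-concatMap-≤ f {c} f≤ (x ∷ xs) = begin
  length (f x ++ concatMap f xs)          ≡⟨ length-++ (f x) ⟩
  length (f x) + length (concatMap f xs)  ≤⟨ +-mono-≤ (f≤ x) (length-concatMap-≤ f f≤ xs) ⟩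
  c + length xs * c                       ∎
  where open ≤-Reasoning

∈-concatMap : ∀ {A B : Set} (f : A → List B) {x xs y} → x ∈ xs → y ∈ f x → y ∈ concatMap f xs
∈-concatMap f x∈ y∈ = ∈-concatMap⁺ f (lose x∈ y∈)

-- Cops in excess of the list probe the default `o`.
fromList : ∀ {A : Set} → A → List A → ∀ {K} → Fin K → A
fromList o []       _              = o
fromList o (x ∷ xs) Data.Fin.zero    = x
fromList o (x ∷ xs) (Data.Fin.suc j) = fromList o xs j

fromList-hits : ∀ {A : Set} (o : A) {xs K x} → length xs ≤ K → x ∈ xs → ∃ λ (j : Fin K) → fromList o xs j ≡ x
fromList-hits o (s≤s _)  (here refl) = Data.Fin.zero , refl
fromList-hits o (s≤s le) (there x∈)  = let j , eq = fromList-hits o le x∈ in Data.Fin.suc j , eq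

data Motion : Set where
  stay move : Motion

module Lookahead {n : ℕ} (G : SimpleGraph n) (q : ℕ)
  (d : Fin n → Fin n → ℕ) (dist : ∀ u v → Dist (toGraph G) u v (d u v))
  (δ : ℕ) (d≤δ : ∀ u v → d u v ≤ δ) where

  open Simulation G q d dist
  open Answers η

  motion : ∀ {u v} → u ⇢ v → Motion
  motion (inj₁ _) = stay
  motion (inj₂ _) = move

  -- The answer under an assumed motion, for `k ≥ 1`. It depends on `u` and `v` through their
  -- distances to the ends of `p` only, so vertices that the probes fail to distinguish give the
  -- same reply.
  reply : Motion → Point → (k : ℕ) → Fin n → Fin n → ℕ
  reply stay p k u v = vertexDist p u
  reply move p k u v = edgeDist p k u v

  Agree : Point → Fin n → Fin n → Set
  Agree p u u′ = d (endA p) u ≡ d (endA p) u′ × d (endB p) u ≡ d (endB p) u′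

  distH-reply : ∀ p {k u v} → suc k ≤ q → (m : u ⇢ v) → distH p (point (suc k) u v) ≡ reply (motion m) p (suc k) u v
  distH-reply p {k} {u} k<q (inj₁ refl) = cong (distH p) (point-stay (suc k) u)
  distH-reply p k<q (inj₂ a)    = distH-point p k<q a

  vertexDist-cong : ∀ p {u u′} → Agree p u u′ → vertexDist p u ≡ vertexDist p u′
  vertexDist-cong p (eqA , eqB) = cong₂ (toVertex (offset p)) eqA eqB

  reply-cong : ∀ m p k {u u′ v v′} → Agree p u u′ → Agree p v v′ → reply m p k u v ≡ reply m p k u′ v′
  reply-cong stay p k uu′ _ = vertexDist-cong p uu′
  reply-cong move p k (eqA , eqB) (eqA′ , eqB′) rewrite eqA | eqB | eqA′ | eqB′ = refl

  -- For rounds on an edge whose first vertex `u` has already been probed; `unknownAnswers` is for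
  -- an edge whose first vertex is being probed now.
  knownAnswers : Motion → Fin n → ℕ → Point → List ℕ
  knownAnswers stay u k p = vertexDist p u ∷ []
  knownAnswers move u k p = nearAnswers (offset p) k (d (endA p) u) (d (endB p) u)

  atVertexAnswers : Point → List ℕ
  atVertexAnswers p = vertexAnswers δ (offset p)

  unknownAnswers : Motion → ℕ → Point → List ℕ
  unknownAnswers stay k p = atVertexAnswers p
  unknownAnswers move k p = farAnswers δ (offset p) k

  reply∈known : ∀ p k {u₀ u v} → Agree p u₀ u → (m : u ⇢ v) →
                reply (motion m) p k u v ∈ knownAnswers (motion m) u₀ k p
  reply∈known p k uu (inj₁ _) = here (sym (vertexDist-cong p uu))
  reply∈known p k {u₀} {u} {v} (eqA , eqB) (inj₂ a) rewrite eqA | eqB =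
    toEdge∈nearAnswers (offset p) k _ _ _ _ (d-step′ (endA p) a) (d-step (endA p) a) (d-step′ (endB p) a) (d-step (endB p) a)

  vertexDist∈ : ∀ p u → vertexDist p u ∈ atVertexAnswers p
  vertexDist∈ p u = toVertex∈vertexAnswers δ (offset p) (d≤δ _ _) (d≤δ _ _)

  reply∈unknown : ∀ m p k u v → reply m p k u v ∈ unknownAnswers m k p
  reply∈unknown stay p k u v = vertexDist∈ p u
  reply∈unknown move p k u v = toEdge∈farAnswers δ (offset p) k (d≤δ _ _) (d≤δ _ _) (d≤δ _ _) (d≤δ _ _)

  -- For each of the coming rounds, the answers to be reckoned with; `collect` runs through the
  -- resulting part of the strategy tree.
  Levels : Set
  Levels = List (Point → List ℕ)

  ends : Point → List (Fin n)
  ends p = endA p ∷ endB p ∷ []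

  collect : ∀ {r} → Levels → Strategy r → List (Fin n)
  collect []       _       = []
  collect (A ∷ As) done    = []
  collect (A ∷ As) (p ▹ f) = ends p ++ concatMap (λ a → ends (proj₁ (f a)) ++ collect As (proj₂ (f a))) (A p)

  descend : (ℕ → Point → List ℕ) → ℕ → Levels → Levels
  descend A zero    L = L
  descend A (suc k) L = A (suc k) ∷ descend A k L

  fromVertex : Motion → Levels
  fromVertex m = atVertexAnswers ∷ descend (unknownAnswers m) q []

  -- The distances to `v` are measured in a single round on the original graph but used in
  -- `2 * q + 1` rounds of the strategy: `q` on the way to `v`, one at `v`, and `q` on the way to
  -- the next vertex.
  fullRound : Motion → Fin n → Motion → Levels
  fullRound m₁ u m₂ = descend (knownAnswers m₁ u) q (fromVertex m₂)

  record Probed {r} (Q : List (Fin n)) (L : Levels) (σ : Strategy r) : Set where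
    constructor probed
    field contains : collect L σ ⊆ Q

  module _ {r : ℕ} {A : Point → List ℕ} {L : Levels} {p : Point} {f : ℕ → Point × Strategy r} {Q : List (Fin n)}
           (P : Probed Q (A ∷ L) (p ▹ f)) where

    open Probed P

    private
      sub : ℕ → List (Fin n)
      sub a = ends (proj₁ (f a)) ++ collect L (proj₂ (f a))

    probe-ends : ends p ⊆ Q
    probe-ends x∈ = contains (∈-++⁺ˡ x∈)

    name-ends : ∀ {a} → a ∈ A p → ends (proj₁ (f a)) ⊆ Q
    name-ends a∈ x∈ = contains (∈-++⁺ʳ (ends p) (∈-concatMap sub a∈ (∈-++⁺ˡ x∈)))

    probed-tail : ∀ {a} → a ∈ A p → Probed Q L (proj₂ (f a))
    probed-tail {a} a∈ = probed λ x∈ →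
      contains (∈-++⁺ʳ (ends p) (∈-concatMap sub a∈ (∈-++⁺ʳ (ends (proj₁ (f a))) x∈)))

  named⇒∈ends : ∀ k {u v y} → point k u v ≡ y → v ∈ ends y
  named⇒∈ends k {u} {v} refl with point-end k u v
  ... | inj₁ eq = here (sym eq)
  ... | inj₂ eq = there (here (sym eq))

  -- x cannot be told from u by the probes that σ makes while the robber walks from u to v.
  Tracks : ∀ {r} → (k : ℕ) → Strategy r → Fin n → Fin n → Fin n → Set
  Tracks zero    σ       x u v = ⊤
  Tracks (suc k) done    x u v = ⊤
  Tracks (suc k) (p ▹ f) x u v = Agree p x u × Tracks k (proj₂ (f (distH p (point (suc k) u v)))) x u v

  -- Answers are computed from the witnesses `u` and `x` in place of the robber's true vertices,
  -- which the cops do not know.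
  follow : ∀ {r} → Motion → Fin n → Fin n → (k : ℕ) → Strategy (k + r) → Strategy r
  follow m u x zero    σ       = σ
  follow m u x (suc k) (p ▹ f) = follow m u x k (proj₂ (f (reply m p (suc k) u x)))

  passVertex : ∀ {r} → Fin n → Strategy (suc r) → Strategy r
  passVertex x (p ▹ f) = proj₂ (f (vertexDist p x))

  module _ {Q : List (Fin n)} {x v : Fin n} (same : ∀ {w} → w ∈ Q → d w x ≡ d w v) where

    agree : ∀ p → ends p ⊆ Q → Agree p x v
    agree p ⊆Q = same (⊆Q (here refl)) , same (⊆Q (there (here refl)))

    -- The probes that the strategy may make on the edge leaving `v` have their ends in `Q` already,
    -- so `x` and `v` agree on them before the robber leaves.
    tracks : ∀ {r} k (σ : Strategy r) {w} (m : v ⇢ w) → k ≤ q →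
             Probed Q (descend (unknownAnswers (motion m)) k []) σ → Tracks k σ x v w
    tracks zero    σ       m k≤q P = tt
    tracks (suc k) done    m k≤q P = tt
    tracks (suc k) (p ▹ f) {w} m k<q P =
      agree p (probe-ends P) ,
      tracks k _ m (<⇒≤ k<q) (probed-tail P
        (subst (_∈ unknownAnswers (motion m) (suc k) p) (sym (distH-reply p k<q m)) (reply∈unknown (motion m) p (suc k) v w)))

    module _ (v∉Q : v ∉ Q) where

      -- The simulated answers are the true ones, because the witnesses agree with `u` and `v` at
      -- the ends of each probe. No name given on the way can be right, as its ends lie in `Q` and
      -- `v` does not; so the correct one is still to come.
      follow-sure : ∀ {r u₀ u} k (σ : Strategy (k + r)) {L} (m : u ⇢ v) → k ≤ q → Tracks k σ u₀ u v →
                    Probed Q (descend (knownAnswers (motion m) u₀) k L) σ → Sure σ k u v →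
                    Sure (follow (motion m) u₀ x k σ) 0 u v × Probed Q L (follow (motion m) u₀ x k σ)
      follow-sure zero σ m k≤q _ P sure = sure , P
      follow-sure {u₀ = u₀} {u} (suc k) (p ▹ f) {L} m k<q (uu , tr) P sure =
        subst (λ a → Sure (follow (motion m) u₀ x k (proj₂ (f a))) 0 u v ×
                     Probed Q L (follow (motion m) u₀ x k (proj₂ (f a))))
              (trans (distH-reply p k<q m) (sym (reply-cong (motion m) p (suc k) uu (agree p (probe-ends P)))))
              (go sure)
        where
        a : ℕ
        a = distH p (point (suc k) u v)
        a∈ : a ∈ knownAnswers (motion m) u₀ (suc k) p
        a∈ = subst (_∈ knownAnswers (motion m) u₀ (suc k) p) (sym (distH-reply p k<q m)) (reply∈known p (suc k) uu m)
        go : Sure (p ▹ f) (suc k) u v →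
             Sure (follow (motion m) u₀ x k (proj₂ (f a))) 0 u v × Probed Q L (follow (motion m) u₀ x k (proj₂ (f a)))
        go (inj₁ named)   = ⊥-elim (v∉Q (name-ends P a∈ (named⇒∈ends (suc k) named)))
        go (inj₂ sureNext) = follow-sure k (proj₂ (f a)) m (<⇒≤ k<q) tr (probed-tail P a∈) sureNext

      passVertex-sure : ∀ {r u w} (σ : Strategy (suc r)) (m : v ⇢ w) → Probed Q (fromVertex (motion m)) σ →
                        Sure σ 0 u v → Tracks q (passVertex x σ) x v w × Sure (passVertex x σ) q v w
      passVertex-sure {u = u} (p ▹ f) m P sure rewrite vertexDist-cong p (agree p (probe-ends P)) with sure
      ... | inj₁ named = ⊥-elim (v∉Q (name-ends P (vertexDist∈ p v) (named⇒∈ends 0 {u} named)))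
      ... | inj₂ next  = tracks q _ m ≤-refl (probed-tail P (vertexDist∈ p v)) , next _ m

  -- Equal to `b * η`, in a form whose `q` rounds are consumed by `follow` and whose single round by
  -- `passVertex`.
  blocks : ℕ → ℕ
  blocks zero    = 0
  blocks (suc b) = q + suc (blocks b)

  -- A hypothesis on which rounds the robber stayed put in, with the strategy resulting from it and a
  -- vertex that all probes so far fail to distinguish from the robber's last position.
  record Thread (b : ℕ) : Set where
    constructor thread
    field
      strategy : Strategy (blocks b)
      witness  : Fin n

  Fits : ∀ {b} → Thread b → Fin n → Set
  Fits (thread σ x) v = ∃ λ u → u ⇢ v × Tracks q σ x u v × Sure σ q u v

  advance : ∀ {b} → Fin n → Motion → Thread (suc b) → Thread b
  advance x m (thread σ u) = thread (passVertex x (follow m u x q σ)) x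

  -- The number of probes needed by a thread

  B₁ B₂ cost : ℕ
  B₁ = 5
  B₂ = 4 * δ + 3
  -- `B₁` answers in each of `q` rounds before `v`, `B₂` answers at `v` and in each of `q` rounds
  -- after it; the 4 is the slack of `CostAtMost`.
  cost = B₁ ^ q * (B₂ * (B₂ ^ q * 4))

  -- With `b` answers, a level turns a length `l` into at most `2 + b * (2 + l)`. Adding 4 makes
  -- this multiplicative: `6 + b * (2 + l) ≤ b * (l + 4)` once `3 ≤ b`.
  CostAtMost : ℕ → Levels → Set
  CostAtMost c L = ∀ {r} (σ : Strategy r) → length (collect L σ) + 4 ≤ c

  ∷-cost : ∀ {c L b} {A : Point → List ℕ} → (∀ p → length (A p) ≤ b) → 3 ≤ b → CostAtMost c L → CostAtMost (b * c) (A ∷ L)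
  ∷-cost {c} {L} {b} {A} A≤ 3≤b L≤ = bound
    where
    open ≤-Reasoning
    4≤c : 4 ≤ c
    4≤c = ≤-trans (m≤n+m 4 _) (L≤ done)
    c≡ : 2 + (c ∸ 2) ≡ c
    c≡ = m+[n∸m]≡n (≤-trans (m≤n+m 2 2) 4≤c)
    bound : CostAtMost (b * c) (A ∷ L)
    bound done    = *-mono-≤ (≤-trans (s≤s z≤n) 3≤b) 4≤c
    bound (p ▹ f) = begin
      (2 + length (concatMap sub (A p))) + 4  ≡⟨ +-comm (2 + length (concatMap sub (A p))) 4 ⟩
      6 + length (concatMap sub (A p))        ≤⟨ +-monoʳ-≤ 6 (length-concatMap-≤ sub sub≤ (A p)) ⟩
      6 + length (A p) * (c ∸ 2)              ≤⟨ +-mono-≤ (*-monoˡ-≤ 2 3≤b) (*-monoˡ-≤ (c ∸ 2) (A≤ p)) ⟩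
      b * 2 + b * (c ∸ 2)                     ≡⟨ sym (*-distribˡ-+ b 2 (c ∸ 2)) ⟩
      b * (2 + (c ∸ 2))                       ≡⟨ cong (b *_) c≡ ⟩
      b * c                                   ∎
      where
      sub : ℕ → List (Fin n)
      sub a = ends (proj₁ (f a)) ++ collect L (proj₂ (f a))
      sub≤ : ∀ a → length (sub a) ≤ c ∸ 2
      sub≤ a = +-cancelˡ-≤ 2 _ _ (begin
        4 + length (collect L (proj₂ (f a)))  ≡⟨ +-comm 4 _ ⟩
        length (collect L (proj₂ (f a))) + 4  ≤⟨ L≤ (proj₂ (f a)) ⟩
        c                                     ≡⟨ sym c≡ ⟩
        2 + (c ∸ 2)                           ∎)

  descend-cost : ∀ {c L b} {A : ℕ → Point → List ℕ} k → (∀ k p → length (A k p) ≤ b) → 3 ≤ b → CostAtMost c L →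
                 CostAtMost (b ^ k * c) (descend A k L)
  descend-cost {c} zero A≤ 3≤b L≤ σ = ≤-trans (L≤ σ) (≤-reflexive (sym (+-identityʳ c)))
  descend-cost {c} {b = b} (suc k) A≤ 3≤b L≤ σ =
    ≤-trans (∷-cost (A≤ (suc k)) 3≤b (descend-cost k A≤ 3≤b L≤) σ) (≤-reflexive (sym (*-assoc b (b ^ k) c)))

  length-known : ∀ m u k p → length (knownAnswers m u k p) ≤ B₁
  length-known stay u k p = s≤s z≤n
  length-known move u k p = ≤-refl

  length-unknown : ∀ m k p → length (unknownAnswers m k p) ≤ B₂
  length-unknown stay k p = length-vertexAnswers δ (offset p)
  length-unknown move k p = length-farAnswers δ (offset p) k

  3≤B₂ : 3 ≤ B₂
  3≤B₂ = m≤n+m 3 (4 * δ)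

  fromVertex-cost : ∀ m → CostAtMost (B₂ * (B₂ ^ q * 4)) (fromVertex m)
  fromVertex-cost m = ∷-cost (λ p → length-vertexAnswers δ (offset p)) 3≤B₂
    (descend-cost q (length-unknown m) 3≤B₂ (λ _ → ≤-refl))

  fullRound-cost : ∀ m₁ u m₂ → CostAtMost cost (fullRound m₁ u m₂)
  fullRound-cost m₁ u m₂ = descend-cost q (length-known m₁ u) (s≤s (s≤s (s≤s z≤n))) (fromVertex-cost m₂)

  motions : List Motion
  motions = stay ∷ move ∷ []

  ∈-motions : ∀ m → m ∈ motions
  ∈-motions stay = here refl
  ∈-motions move = there (here refl)

  -- Neither the motion that led to the present vertex nor the one that follows is observable, hence
  -- all four combinations.
  threadProbes : ∀ {b} → Thread b → List (Fin n)
  threadProbes (thread σ u) = concatMap (λ m₁ → concatMap (λ m₂ → collect (fullRound m₁ u m₂) σ) motions) motions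

  probes : ∀ {b} → List (Thread b) → List (Fin n)
  probes = concatMap threadProbes

  length-threadProbes : ∀ {b} (τ : Thread b) → length (threadProbes τ) ≤ 2 * (2 * cost)
  length-threadProbes (thread σ u) =
    length-concatMap-≤ (λ m₁ → concatMap (λ m₂ → collect (fullRound m₁ u m₂) σ) motions)
      (λ m₁ → length-concatMap-≤ (λ m₂ → collect (fullRound m₁ u m₂) σ) (λ m₂ → ≤-trans (m≤m+n _ 4) (fullRound-cost m₁ u m₂ σ)) motions) motions

  -- Playing all simulations at once

  module _ (o : Fin n) where

    module _ {K : ℕ} (Q : List (Fin n)) (Q≤K : length Q ≤ K) where

      probing : Fin K → Fin n
      probing = fromList o Q

      Consistent : (Fin n → Set) → Fin n → Fin n → Set
      Consistent S x y = S y × (∀ j → SameAnswer (toGraph G) (probing j) x y)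

      same-distances : ∀ {S x y} → Consistent S x y → ∀ {w} → w ∈ Q → d w x ≡ d w y
      same-distances (_ , same) w∈ with fromList-hits o Q≤K w∈
      ... | j , refl = sameAnswer⇒≡ dist (same j)

      caught : ∀ {S x y} → Consistent S x y → x ∈ Q ⊎ y ∈ Q → x ≡ y
      caught {S} {x} {y} c (inj₁ x∈) = d≡0⇒≡ (trans (sym (same-distances {S} c x∈)) (d-refl x))
      caught {S} {x} {y} c (inj₂ y∈) = sym (d≡0⇒≡ (trans (same-distances {S} c y∈) (d-refl y)))

      round : ∀ {t S} → (∀ x → S x → x ∉ Q → WinIn (toGraph G) K t (ClosedNbhd (toGraph G) (Consistent S x))) → WinIn (toGraph G) K (suc t) S
      round {t} {S} go = inj₂ (probing , λ x Sx → outcome x Sx (_∈?_ F._≟_ x Q))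
        where
        outcome : ∀ x → S x → Dec (x ∈ Q) → AtMostOne (Consistent S x) ⊎ WinIn (toGraph G) K t (ClosedNbhd (toGraph G) (Consistent S x))
        outcome x Sx (yes x∈) = inj₁ (λ y z cy cz →
          trans (sym (caught {S} cy (inj₁ x∈))) (caught {S} cz (inj₁ x∈)))
        outcome x Sx (no x∉)  = inj₂ (go x Sx x∉)

      unseen : ∀ {S x y} → x ∉ Q → Consistent S x y → y ∉ Q
      unseen {S} x∉ c y∈ = x∉ (subst (_∈ Q) (sym (caught {S} c (inj₂ y∈))) y∈)

    -- Each round doubles the threads and uses up one block, so `length 𝓣 * 2 ^ b` does not grow and
    -- `2 ^ T` bounds the number of threads throughout, for a fixed number of cops.
    threads-win : ∀ T b (𝓣 : List (Thread b)) (S : Fin n → Set) → (∀ v → S v → ∃ λ τ → τ ∈ 𝓣 × Fits τ v) →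
                  length 𝓣 * 2 ^ b ≤ 2 ^ T → WinIn (toGraph G) (2 ^ T * (2 * (2 * cost))) b S
    -- With no rounds left `Sure` is empty, so no thread fits and `S` has no element.
    threads-win T zero 𝓣 S cover _ x _ Sx _ = ⊥-elim (impossible q (cover x Sx))
      where
      impossible : ∀ k → (∃ λ (τ : Thread zero) → τ ∈ 𝓣 × ∃ λ u → u ⇢ x × Tracks k (Thread.strategy τ) (Thread.witness τ) u x × Sure (Thread.strategy τ) k u x) → ⊥
      impossible k (thread done _ , _ , _ , _ , _ , ())
    threads-win T (suc b) 𝓣 S cover fits = round Q Q≤K next
      where
      open ≤-Reasoning
      Q : List (Fin n)
      Q = probes 𝓣
      𝓣≤ : length 𝓣 ≤ 2 ^ T
      𝓣≤ = ≤-trans (m≤m*n (length 𝓣) (2 ^ suc b) {{m^n≢0 2 (suc b)}}) fits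
      Q≤K : length Q ≤ 2 ^ T * (2 * (2 * cost))
      Q≤K = ≤-trans (length-concatMap-≤ threadProbes length-threadProbes 𝓣) (*-monoˡ-≤ (2 * (2 * cost)) 𝓣≤)
      next : ∀ x → S x → x ∉ Q → WinIn (toGraph G) _ b (ClosedNbhd (toGraph G) (Consistent Q Q≤K S x))
      next x _ x∉ = threads-win T b 𝓣⁺ _ cover⁺ (begin
          length 𝓣⁺ * 2 ^ b           ≤⟨ *-monoˡ-≤ (2 ^ b) (length-concatMap-≤ successors (λ _ → ≤-refl) 𝓣) ⟩
          (length 𝓣 * 2) * 2 ^ b      ≡⟨ *-assoc (length 𝓣) 2 (2 ^ b) ⟩
          length 𝓣 * 2 ^ suc b        ≤⟨ fits ⟩
          2 ^ T                       ∎)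
        where
        successors : Thread (suc b) → List (Thread b)
        successors τ = advance {b} x stay τ ∷ advance {b} x move τ ∷ []
        ∈-successors : ∀ m τ → advance {b} x m τ ∈ successors τ
        ∈-successors stay τ = here refl
        ∈-successors move τ = there (here refl)
        𝓣⁺ : List (Thread b)
        𝓣⁺ = concatMap successors 𝓣
        cover⁺ : ∀ w → ClosedNbhd (toGraph G) (Consistent Q Q≤K S x) w → ∃ λ τ → τ ∈ 𝓣⁺ × Fits {b} τ w
        cover⁺ w (v , c , v⇢w) with cover v (proj₁ c)
        ... | τ@(thread σ u₀) , τ∈ , u , u⇢v , tr , sure =
          advance {b} x (motion u⇢v) τ , ∈-concatMap successors τ∈ (∈-successors (motion u⇢v) τ) ,
          v , v⇢w , passVertex-sure same v∉ {u = u} _ v⇢w (proj₂ followed) (proj₁ followed)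
          where
          same : ∀ {z} → z ∈ Q → d z x ≡ d z v
          same = same-distances Q Q≤K {S} c
          v∉ : v ∉ Q
          v∉ = unseen Q Q≤K {S} x∉ c
          covered : Probed Q (fullRound (motion u⇢v) u₀ (motion v⇢w)) σ
          covered = probed λ z∈ → ∈-concatMap threadProbes τ∈
            (∈-concatMap (λ m₁ → concatMap (λ m₂ → collect (fullRound m₁ u₀ m₂) σ) motions) (∈-motions (motion u⇢v))
              (∈-concatMap (λ m₂ → collect (fullRound (motion u⇢v) u₀ m₂) σ) (∈-motions (motion v⇢w)) z∈))
          followed = follow-sure same v∉ {u₀ = u₀} {u = u} q σ u⇢v ≤-refl tr covered sure

    -- The extra round of `σ` is played at the starting vertex, which no edge precedes; therefore
    -- `fromVertex` suffices for the first probes.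
    strategy-wins : ∀ T (σ : Strategy (suc (blocks T))) → (∀ {u v} → u ⇢ v → Sure σ 0 u v) →
                    Localizable (toGraph G) (2 ^ T * (2 * (2 * cost)))
    strategy-wins T σ sure = suc T , round Q Q≤K next
      where
      open ≤-Reasoning
      Q : List (Fin n)
      Q = concatMap (λ m → collect (fromVertex m) σ) motions
      Q≤K : length Q ≤ 2 ^ T * (2 * (2 * cost))
      Q≤K = begin
        length Q                     ≤⟨ length-concatMap-≤ (λ m → collect (fromVertex m) σ) (λ m → ≤-trans (m≤m+n _ 4) (fromVertex-cost m σ)) motions ⟩
        2 * (B₂ * (B₂ ^ q * 4))      ≤⟨ *-monoʳ-≤ 2 (m≤n*m _ (B₁ ^ q) {{m^n≢0 B₁ q}}) ⟩
        2 * cost                     ≤⟨ m≤n*m (2 * cost) 2 ⟩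
        2 * (2 * cost)               ≤⟨ m≤n*m _ (2 ^ T) {{m^n≢0 2 T}} ⟩
        2 ^ T * (2 * (2 * cost))     ∎
      next : ∀ x → ⊤ → x ∉ Q → WinIn (toGraph G) _ T (ClosedNbhd (toGraph G) (Consistent Q Q≤K (λ _ → ⊤) x))
      next x _ x∉ = threads-win T T (thread (passVertex x σ) x ∷ []) _ cover (≤-reflexive (+-identityʳ (2 ^ T)))
        where
        cover : ∀ w → ClosedNbhd (toGraph G) (Consistent Q Q≤K (λ _ → ⊤) x) w → ∃ λ τ → τ ∈ thread (passVertex x σ) x ∷ [] × Fits {T} τ w
        cover w (v , c , v⇢w) = _ , here refl , v , v⇢w ,
          passVertex-sure (same-distances Q Q≤K {λ _ → ⊤} c) (unseen Q Q≤K {λ _ → ⊤} x∉ c) {u = v} σ v⇢w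
            -- The start `v` is regarded as reached from `v` by staying.
            (probed (∈-concatMap (λ m → collect (fromVertex m) σ) (∈-motions (motion v⇢w)))) (sure (inj₁ refl))

-- Diameter one

fresh : ∀ {n} (F : List (Fin n)) → length F < n → ∃ λ w → w ∉ F
fresh {n} F F<n = F.¬∀⟶∃¬ n (_∈ F) (λ w → _∈?_ F._≟_ w F) λ all →
  let i , j , i<j , eq = F.pigeonhole F<n (λ w → index (all w))
  in F.<-irrefl (trans (lookup-index (all i)) (trans (cong (lookup F) eq) (sym (lookup-index (all j))))) i<j

module CompleteGraph {n : ℕ} (G : SimpleGraph n) (q : ℕ)
  (d : Fin n → Fin n → ℕ) (dist : ∀ u v → Dist (toGraph G) u v (d u v)) (d≤1 : ∀ u v → d u v ≤ 1) where

  open Simulation G q d dist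

  d≡1 : ∀ {u v} → u ≢ v → d u v ≡ 1
  d≡1 {u} {v} u≢v = ≤-antisym (d≤1 u v) (n≢0⇒n>0 (u≢v ∘ d≡0⇒≡))

  ≢⇒adj : ∀ {u v} → u ≢ v → adj G u v ≡ true
  ≢⇒adj {u} {v} u≢v with d u v | proj₁ (dist u v) | d≡1 u≢v
  ... | .1 | step a (here _) | refl = a

  -- In a complete graph a target other than `u` and the ends of `p` is at distance 1 from both
  -- ends, so the formula gives one common value.
  distH-generic : ∀ p k {u w} → k ≤ q → w ∉ u ∷ endA p ∷ endB p ∷ [] →
                  ∀ {w′} → w′ ∉ u ∷ endA p ∷ endB p ∷ [] → distH p (point k u w) ≡ distH p (point k u w′)
  distH-generic p k {u} k≤q w∉ w′∉ = trans (generic k k≤q w∉) (sym (generic k k≤q w′∉))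
    where
    value : ℕ → ℕ
    value zero    = toVertex (offset p) 1 1
    value (suc k) = toEdge (offset p) (suc k) (d (endA p) u) (d (endB p) u) 1 1
    generic : ∀ k {w} → k ≤ q → w ∉ u ∷ endA p ∷ endB p ∷ [] → distH p (point k u w) ≡ value k
    generic zero k≤q w∉ = cong₂ (toVertex (offset p))
      (d≡1 (λ eq → w∉ (there (here (sym eq))))) (d≡1 (λ eq → w∉ (there (there (here (sym eq))))))
    generic (suc k) k≤q w∉ = trans (distH-point p k≤q (≢⇒adj (λ eq → w∉ (here (sym eq)))))
      (cong₂ (toEdge (offset p) (suc k) (d (endA p) u) (d (endB p) u))
        (d≡1 (λ eq → w∉ (there (here (sym eq))))) (d≡1 (λ eq → w∉ (there (there (here (sym eq)))))))

  two-targets : ∀ k u F {S : Point → Set} → length F + 3 ≤ n → (∀ {w} → w ∉ u ∷ F → S (point k u w)) → ¬ AtMostOne S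
  two-targets k u F room targets one =
    let w₁ , w₁∉ = fresh (u ∷ F) (≤-trans (≤-trans (n≤1+n _) (≤-reflexive (+-comm 3 (length F)))) room)
        w₂ , w₂∉ = fresh (w₁ ∷ u ∷ F) (≤-trans (≤-reflexive (+-comm 3 (length F))) room)
    in distinct w₂∉ (one _ _ (targets (w₂∉ ∘ there)) (targets w₁∉))
    where
    distinct : ∀ {w₁ w₂} → w₂ ∉ w₁ ∷ u ∷ F → point k u w₂ ≢ point k u w₁
    distinct {w₁} {w₂} w₂∉ eq
      with point-ends k u w₁ (subst (λ y → endA y ≡ w₂ ⊎ endB y ≡ w₂) eq (point-end k u w₂))
    ... | inj₁ w₂≡u  = w₂∉ (there (here w₂≡u))
    ... | inj₂ w₂≡w₁ = w₂∉ (here w₂≡w₁)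

  -- All targets outside `u ∷ F` remain possible. Each probe adds its two ends to `F` while `k`
  -- drops by one, so `length F + 2 * k` is preserved; the 5 leaves room for the two ends of the
  -- current probe, for `u`, and for two different targets.
  evade : 2 * q + 5 ≤ n → ∀ t k u F {S} → k ≤ q → length F + 2 * k + 5 ≤ n →
          (∀ {w} → w ∉ u ∷ F → S (point k u w)) → ¬ WinIn Hᴳ 1 t S
  evade large t k u F {S} k≤q room targets = fails t
    where
    room₅ : length F + 5 ≤ n
    room₅ = ≤-trans (+-monoˡ-≤ 5 (m≤m+n (length F) (2 * k))) room

    ¬one : ¬ AtMostOne S
    ¬one = two-targets k u F (≤-trans (+-monoʳ-≤ (length F) (m≤n+m 3 2)) room₅) targets

    fails : ∀ t → ¬ WinIn Hᴳ 1 t S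
    fails zero    one        = ¬one one
    fails (suc t) (inj₁ one) = ¬one one
    fails (suc t) (inj₂ (probe , win)) = outcome (win (point k u w₀) (targets (w₀∉ ∘ outer)))
      where
      p : Point
      p = probe Data.Fin.zero
      F⁺ : List (Fin n)
      F⁺ = endA p ∷ endB p ∷ F
      outer : u ∷ F ⊆ u ∷ F⁺
      outer (here eq)  = here eq
      outer (there x∈) = there (there (there x∈))
      inner : u ∷ endA p ∷ endB p ∷ [] ⊆ u ∷ F⁺
      inner (here eq)                 = here eq
      inner (there (here eq))         = there (here eq)
      inner (there (there (here eq))) = there (there (here eq))
      room⁺ : length F⁺ + 3 ≤ n
      room⁺ = ≤-trans (≤-reflexive (sym (trans (+-suc _ 4) (cong suc (+-suc _ 3))))) room₅
      chosen : ∃ λ w → w ∉ u ∷ F⁺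
      chosen = fresh (u ∷ F⁺) (≤-trans (≤-trans (n≤1+n _) (≤-reflexive (+-comm 3 (length F⁺)))) room⁺)
      w₀ : Fin n
      w₀ = proj₁ chosen
      w₀∉ : w₀ ∉ u ∷ F⁺
      w₀∉ = proj₂ chosen
      S⁺ : Point → Set
      S⁺ y = S y × (∀ j → SameAnswer Hᴳ (probe j) (point k u w₀) y)
      targets⁺ : ∀ {w} → w ∉ u ∷ F⁺ → S⁺ (point k u w)
      targets⁺ w∉ = targets (w∉ ∘ outer) ,
        λ { Data.Fin.zero → ≡⇒sameAnswer Dist-distH (distH-generic p k k≤q (w₀∉ ∘ inner) (w∉ ∘ inner)) }
      continue : ∀ k′ → k′ ≡ k → ¬ WinIn Hᴳ 1 t (ClosedNbhd Hᴳ S⁺)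
      continue (suc k′) refl = evade large t k′ u F⁺ (<⇒≤ k≤q)
        (≤-trans (≤-reflexive (shift (length F) k′)) room)
        (λ w∉ → _ , targets⁺ w∉ , point-advance k≤q (inj₂ (≢⇒adj (λ eq → w∉ (here (sym eq))))))
        where
        shift : ∀ f k → 2 + f + 2 * k + 5 ≡ f + 2 * suc k + 5
        shift = solve-∀
      -- The robber may be at `w₀`, free to go to any other vertex, so the list of excluded targets
      -- starts empty again.
      continue zero refl = evade large t q w₀ [] ≤-refl large
        (λ w∉ → _ , targets⁺ w₀∉ , point-depart (inj₂ (≢⇒adj (λ eq → w∉ (here (sym eq))))))
      outcome : ¬ (AtMostOne S⁺ ⊎ WinIn Hᴳ 1 t (ClosedNbhd Hᴳ S⁺))
      outcome (inj₁ one) = two-targets k u F⁺ room⁺ targets⁺ one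
      outcome (inj₂ win) = continue k refl win

  few-vertices : Fin n → Localizable Hᴳ 1 → n ≤ 2 * q + 5
  few-vertices o (t , win) = ≮⇒≥ λ lt →
    evade (<⇒≤ lt) t 0 o [] z≤n (≤-trans (m≤n+m 5 (2 * q)) (<⇒≤ lt)) (λ _ → tt) win

-- Monotonicity in time and the trivial bound on the number of cops

WinIn-mono : ∀ {H k t t′ S} → t ≤ t′ → WinIn H k t S → WinIn H k t′ S
WinIn-mono {t = zero}  {zero}   _         win        = win
WinIn-mono {t = zero}  {suc t′} _         win        = inj₁ win
WinIn-mono {t = suc t} {suc t′} _         (inj₁ one) = inj₁ one
WinIn-mono {t = suc t} {suc t′} (s≤s t≤) (inj₂ (p , win)) =
  inj₂ (p , λ x Sx → map₂ (WinIn-mono t≤) (win x Sx))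

probe-everywhere : ∀ {n} (G : SimpleGraph n) → Localizable (toGraph G) n
probe-everywhere G = 1 , inj₂ (id , λ x _ → inj₁ λ y z (_ , sy) (_ , sz) → trans (sym (at x (sy x))) (at x (sz x)))
  where
  at : ∀ x {y} → SameAnswer (toGraph G) x x y → x ≡ y
  at x same with proj₁ (proj₁ (same 0) (Dist-refl x))
  ... | here _ = refl

-- Counting the cops

^-distribʳ-* : ∀ a b m → (a * b) ^ m ≡ a ^ m * b ^ m
^-distribʳ-* a b zero    = refl
^-distribʳ-* a b (suc m) rewrite ^-distribʳ-* a b m = interchange a b (a ^ m) (b ^ m)
  where
  interchange : ∀ a b x y → (a * b) * (x * y) ≡ (a * x) * (b * y)
  interchange = solve-∀

-- Here `c` is `capt / η` rounded down; the power `η` turns `2 ^ c` into `2 ^ (c * η)`, which is at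
-- most `2 ^ capt`.
power-bound : ∀ {ζ η capt δ} c → c * η ≤ capt → ζ ≤ 32 * 2 ^ c * (16 * (δ * δ)) ^ η →
              ζ ^ η ≤ 32 ^ η * 2 ^ capt * 16 ^ (η * η) * δ ^ (2 * η * η)
power-bound {ζ} {η} {capt} {δ} c cη≤ ζ≤ = begin
  ζ ^ η                                                    ≤⟨ ^-monoˡ-≤ η ζ≤ ⟩
  (32 * 2 ^ c * (16 * (δ * δ)) ^ η) ^ η                    ≡⟨ ^-distribʳ-* (32 * 2 ^ c) _ η ⟩
  (32 * 2 ^ c) ^ η * ((16 * (δ * δ)) ^ η) ^ η              ≡⟨ cong₂ _*_ (trans (^-distribʳ-* 32 (2 ^ c) η) (cong (32 ^ η *_) (^-*-assoc 2 c η))) tail ⟩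
  32 ^ η * 2 ^ (c * η) * (16 ^ (η * η) * δ ^ (2 * η * η))  ≡⟨ sym (*-assoc (32 ^ η * 2 ^ (c * η)) _ _) ⟩
  32 ^ η * 2 ^ (c * η) * 16 ^ (η * η) * δ ^ (2 * η * η)    ≤⟨ *-monoˡ-≤ (δ ^ (2 * η * η)) (*-monoˡ-≤ (16 ^ (η * η)) (*-monoʳ-≤ (32 ^ η) (^-monoʳ-≤ 2 cη≤))) ⟩
  32 ^ η * 2 ^ capt * 16 ^ (η * η) * δ ^ (2 * η * η)       ∎
  where
  open ≤-Reasoning
  tail : ((16 * (δ * δ)) ^ η) ^ η ≡ 16 ^ (η * η) * δ ^ (2 * η * η)
  tail = begin-equality
    ((16 * (δ * δ)) ^ η) ^ η           ≡⟨ ^-*-assoc (16 * (δ * δ)) η η ⟩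
    (16 * (δ * δ)) ^ (η * η)           ≡⟨ ^-distribʳ-* 16 (δ * δ) (η * η) ⟩
    16 ^ (η * η) * (δ * δ) ^ (η * η)   ≡⟨ cong (λ x → 16 ^ (η * η) * (δ * x) ^ (η * η)) (sym (*-identityʳ δ)) ⟩
    16 ^ (η * η) * (δ ^ 2) ^ (η * η)   ≡⟨ cong (16 ^ (η * η) *_) (trans (^-*-assoc δ 2 (η * η)) (cong (δ ^_) (sym (*-assoc 2 η η)))) ⟩
    16 ^ (η * η) * δ ^ (2 * η * η)     ∎

q≤16^q : ∀ q → q ≤ 16 ^ q
q≤16^q zero    = z≤n
q≤16^q (suc q) = begin
  1 + q             ≤⟨ +-mono-≤ (m^n>0 16 q) (q≤16^q q) ⟩
  16 ^ q + 16 ^ q   ≤⟨ +-monoʳ-≤ (16 ^ q) (m≤m+n (16 ^ q) (14 * 16 ^ q)) ⟩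
  16 * 16 ^ q       ∎
  where open ≤-Reasoning

2q+5≤ : ∀ q c → 2 * q + 5 ≤ 32 * 2 ^ c * 16 ^ suc q
2q+5≤ q c = begin
  2 * q + 5               ≤⟨ +-mono-≤ (*-monoʳ-≤ 2 (q≤16^q q)) (m≤m*n 5 (16 ^ q) {{m^n≢0 16 q}}) ⟩
  2 * 16 ^ q + 5 * 16 ^ q ≡⟨ sym (*-distribʳ-+ (16 ^ q) 2 5) ⟩
  7 * 16 ^ q              ≤⟨ *-mono-≤ (≤-trans (m≤n+m 7 25) (m≤m*n 32 (2 ^ c) {{m^n≢0 2 c}})) (m≤n*m (16 ^ q) 16) ⟩
  32 * 2 ^ c * 16 ^ suc q ∎
  where open ≤-Reasoning

-- Tight at `δ = 2`, with 55 against 64: six near answers would give 66, and counting length `δ` in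
-- all four families of far answers would give 70. It fails at `δ = 1`, with 35 against 16, whence
-- the separate treatment of complete graphs.
branching : ∀ {δ} → 2 ≤ δ → 5 * (4 * δ + 3) ≤ 16 * (δ * δ)
branching {δ} 2≤δ = begin
  5 * (4 * δ + 3)       ≡⟨ expand δ ⟩
  20 * δ + 15           ≤⟨ +-monoʳ-≤ (20 * δ) (≤-trans (m≤n+m 15 9) (*-monoʳ-≤ 12 2≤δ)) ⟩
  20 * δ + 12 * δ       ≡⟨ collect δ ⟩
  16 * (2 * δ)          ≤⟨ *-monoʳ-≤ 16 (*-monoˡ-≤ δ 2≤δ) ⟩
  16 * (δ * δ)          ∎
  where
  open ≤-Reasoning
  expand : ∀ δ → 5 * (4 * δ + 3) ≡ 20 * δ + 15
  expand = solve-∀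
  collect : ∀ δ → 20 * δ + 12 * δ ≡ 16 * (2 * δ)
  collect = solve-∀

cost-bound : ∀ {δ} q c → 2 ≤ δ →
             2 ^ suc c * (2 * (2 * (5 ^ q * ((4 * δ + 3) * ((4 * δ + 3) ^ q * 4))))) ≤ 32 * 2 ^ c * (16 * (δ * δ)) ^ suc q
cost-bound {δ} q c 2≤δ = begin
  -- The constant 32 combines the 2 from the additional block, the 4 pairs of motions and the slack
  -- 4.
  2 ^ suc c * (2 * (2 * (5 ^ q * (B * (B ^ q * 4)))))  ≡⟨ regroup (2 ^ c) (5 ^ q) B (B ^ q) ⟩
  -- One factor 5 is given away to pair each 5 with a `B`.
  32 * 2 ^ c * (5 ^ q * B ^ suc q)                     ≤⟨ *-monoʳ-≤ (32 * 2 ^ c) (*-monoˡ-≤ (B ^ suc q) (m≤n*m (5 ^ q) 5)) ⟩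
  32 * 2 ^ c * (5 ^ suc q * B ^ suc q)                 ≡⟨ cong (32 * 2 ^ c *_) (sym (^-distribʳ-* 5 B (suc q))) ⟩
  32 * 2 ^ c * (5 * B) ^ suc q                         ≤⟨ *-monoʳ-≤ (32 * 2 ^ c) (^-monoˡ-≤ (suc q) (branching 2≤δ)) ⟩
  32 * 2 ^ c * (16 * (δ * δ)) ^ suc q                  ∎
  where
  open ≤-Reasoning
  B : ℕ
  B = 4 * δ + 3
  regroup : ∀ c f b g → (2 * c) * (2 * (2 * (f * (b * (g * 4))))) ≡ 32 * c * (f * (b * g))
  regroup = solve-∀

-- The power `η` on both sides replaces the fractional exponent capt/η by the integer `capt`; `C` is
-- the constant of the O-notation, uniform in all graphs.
theorem4 : ∃ λ (C : ℕ) →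
    ∀ (n : ℕ) (G : SimpleGraph n) → Connected (toGraph G) →
    ∀ (η capt ζ δ : ℕ) →
    IsSubdivisionNumber G η →
    IsCaptureTime G η capt →
    IsLocalizationNumber (toGraph G) ζ →
    IsDiameter (toGraph G) δ →
    ζ ^ η ≤ C ^ η * 2 ^ capt * 16 ^ (η * η) * δ ^ (2 * η * η)
theorem4 = 32 , bound
  where
  bound : ∀ n (G : SimpleGraph n) → Connected (toGraph G) → ∀ η capt ζ δ → IsSubdivisionNumber G η →
          IsCaptureTime G η capt → IsLocalizationNumber (toGraph G) ζ → IsDiameter (toGraph G) δ →
          ζ ^ η ≤ 32 ^ η * 2 ^ capt * 16 ^ (η * η) * δ ^ (2 * η * η)
  bound n G _ zero capt ζ δ (() , _)
  bound n G _ η@(suc q) capt ζ δ (_ , loc , _) (win , _) (_ , minimal) (diam , o , _) = by-diameter δ (λ u v → proj₂ (proj₂ (diam u v)))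
    where
    d : Fin n → Fin n → ℕ
    d u v = proj₁ (diam u v)
    dist : ∀ u v → Dist (toGraph G) u v (d u v)
    dist u v = proj₁ (proj₂ (diam u v))
    open Simulation G q d dist using (extract; d≡0⇒≡; _⇢_; _⇢?_)

    ζ≤ : ∀ {K} → Localizable (toGraph G) K → ζ ≤ K
    ζ≤ {K} locK = ≮⇒≥ (λ K<ζ → minimal K K<ζ locK)

    c : ℕ
    c = capt / η

    by-diameter : ∀ δ → (∀ u v → d u v ≤ δ) → ζ ^ η ≤ 32 ^ η * 2 ^ capt * 16 ^ (η * η) * δ ^ (2 * η * η)
    by-diameter zero d≤ rewrite n≤0⇒n≡0 (ζ≤ (0 , λ x y _ _ → d≡0⇒≡ (n≤0⇒n≡0 (d≤ x y)))) = z≤n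
    by-diameter 1 d≤ = power-bound {δ = 1} c (m/n*n≤m capt η) (begin
      ζ                          ≤⟨ ζ≤ (probe-everywhere G) ⟩
      n                          ≤⟨ CompleteGraph.few-vertices G q d dist d≤ o loc ⟩
      2 * q + 5                  ≤⟨ 2q+5≤ q c ⟩
      32 * 2 ^ c * 16 ^ η        ∎)
      where open ≤-Reasoning
    by-diameter δ@(suc (suc _)) d≤ = power-bound {δ = δ} c (m/n*n≤m capt η)
      (≤-trans (ζ≤ (strategy-wins o (suc c) (proj₁ σ) (proj₂ σ))) (cost-bound q c (s≤s (s≤s z≤n))))
      where
      open Lookahead G q d dist δ d≤
      blocks≡ : ∀ b → blocks b ≡ b * η
      blocks≡ zero    = refl
      blocks≡ (suc b) = trans (+-suc q (blocks b)) (cong (λ m → suc (q + m)) (blocks≡ b))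
      -- As `c` is rounded down, `suc c` blocks are simulated to cover the remainder of `capt`.
      capt≤ : capt ≤ blocks (suc c)
      capt≤ = begin
        capt                 ≡⟨ m≡m%n+[m/n]*n capt η ⟩
        capt % η + c * η     ≤⟨ +-monoˡ-≤ (c * η) (<⇒≤ (m%n<n capt η)) ⟩
        suc c * η            ≡⟨ sym (blocks≡ (suc c)) ⟩
        blocks (suc c)       ∎
        where open ≤-Reasoning
      σ = extract o (blocks (suc c)) 0 z≤n (λ _ → ⊤) _⇢_ _⇢?_ (λ u⇢v → u⇢v , tt) (WinIn-mono capt≤ win)
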